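{- Let $\mathbb{F}_q$ be a finite field with $q \equiv -1 \pmod 3$ and let $E$ be an elliptic curve over $\mathbb{F}_q$ possessing an $\mathbb{F}_q$-rational point of order $3$. Then, besides the subgroup generated by this point, $E$ has another rational subgroup of order $3$, whose nonzero points are not defined over $\mathbb{F}_q$.
   Context: A subgroup $G\subset E(\overline{\mathbb{F}}_q)$ is called rational (over $\mathbb{F}_q$) if it is stable, as a set, under the $q$-power Frobenius map $(x,y)\mapsto(x^q,y^q)$; its individual points need not be defined over $\mathbb{F}_q$. -}

module Defs where

open import Algebra.Bundles using (CommutativeRing; RawGroup; Semiring)
open import Algebra.Definitions using (Invertible)
open import Algebra.Morphism.Structures using (module RingMorphisms)
import Algebra.Definitions.RawMonoid as MonoidMultiples
import Algebra.Definitions.RawSemiring as SemiringPowers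
open import Data.Fin.Base using (Fin)
open import Data.List.Base using (List; []; _∷_; map)
open import Data.Nat.Base as ℕ using (ℕ)
open import Data.Product.Base using (Σ; ∃; ∃₂; _×_; _,_; proj₁)
open import Data.Unit.Polymorphic.Base using (⊤)
open import Function.Bundles using (Inverse)
open import Level using (Level; _⊔_; suc)
open import Relation.Binary.Bundles using (Setoid)
open import Relation.Binary.Definitions using (Decidable; _Respects_)
open import Relation.Binary.PropositionalEquality.Properties using (setoid)
import Relation.Binary.Construct.On as On
open import Relation.Nullary.Decidable.Core using (yes; no)
open import Relation.Nullary.Negation.Core using (¬_)
open import Relation.Unary using (Pred; _∈_; _⊆_)

HasCardinality : ∀ {c ℓ} → Setoid c ℓ → ℕ → Set (c ⊔ ℓ)
HasCardinality S n = Inverse S (setoid (Fin n))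

-- Equality is decidable, as it is in any field classically; the group law
-- on a Weierstrass curve is defined by testing equalities.
record Field c ℓ : Set (suc (c ⊔ ℓ)) where
  infix 4 _≟_
  field
    commutativeRing : CommutativeRing c ℓ

  open CommutativeRing commutativeRing public

  field
    _≟_     : Decidable _≈_
    1≉0     : ¬ 1# ≈ 0#
    inverse : ∀ x → ¬ x ≈ 0# → Invertible _≈_ 1# _*_ x

  divide : (x y : Carrier) → ¬ y ≈ 0# → Carrier
  divide x y y≉0 = x * proj₁ (inverse y y≉0)

  open SemiringPowers (Semiring.rawSemiring semiring) public using (_^_) renaming (_×_ to _·_)

  -- The list c₀ ∷ c₁ ∷ … ∷ cₙ₋₁ ∷ [] stands for the monic polynomial
  -- c₀ + c₁ X + … + cₙ₋₁ Xⁿ⁻¹ + Xⁿ of degree n.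
  evalMonic : List Carrier → Carrier → Carrier
  evalMonic []       x = 1#
  evalMonic (c ∷ cs) x = c + x * evalMonic cs x

module _ {c ℓ c′ ℓ′} (F : Field c ℓ) (K : Field c′ ℓ′) where
  private
    module F = Field F
    module K = Field K

  record IsAlgebraicClosure (ι : F.Carrier → K.Carrier) : Set (c ⊔ ℓ ⊔ c′ ⊔ ℓ′) where
    field
      isRingHomomorphism : RingMorphisms.IsRingHomomorphism F.rawRing K.rawRing ι
      algebraic          : ∀ x → ∃ λ cs → K.evalMonic (map ι cs) x K.≈ K.0#
      algebraicallyClosed : ∀ c cs → ∃ λ x → K.evalMonic (c ∷ cs) x K.≈ K.0#

-- y² + a₁xy + a₃y = x³ + a₂x² + a₄x + a₆, over an arbitrary field, since
-- q may be even.
record Weierstrass {a} (A : Set a) : Set a where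
  field
    a₁ a₂ a₃ a₄ a₆ : A

mapWeierstrass : ∀ {a b} {A : Set a} {B : Set b} → (A → B) → Weierstrass A → Weierstrass B
mapWeierstrass f W = record
  { a₁ = f a₁ ; a₂ = f a₂ ; a₃ = f a₃ ; a₄ = f a₄ ; a₆ = f a₆ }
  where open Weierstrass W

discriminant : ∀ {c ℓ} (F : Field c ℓ) → Weierstrass (Field.Carrier F) → Field.Carrier F
discriminant F W =
  - (b₂ ^ 2 * b₈) - 8 · b₄ ^ 3 - 27 · b₆ ^ 2 + 9 · (b₂ * b₄ * b₆)
  where
  open Field F
  open Weierstrass W
  b₂ b₄ b₆ b₈ : Carrier
  b₂ = a₁ ^ 2 + 4 · a₂
  b₄ = 2 · a₄ + a₁ * a₃
  b₆ = a₃ ^ 2 + 4 · a₆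
  b₈ = a₁ ^ 2 * a₆ + 4 · (a₂ * a₆) - a₁ * a₃ * a₄ + a₂ * a₃ ^ 2 - a₄ ^ 2

record EllipticCurve {c ℓ} (F : Field c ℓ) : Set (c ⊔ ℓ) where
  field
    weierstrass : Weierstrass (Field.Carrier F)
    nonsingular : ¬ Field._≈_ F (discriminant F weierstrass) (Field.0# F)

-- The affine plane together with one point at infinity; the points of a
-- Weierstrass curve are those satisfying OnCurve.
data Point {a} (A : Set a) : Set a where
  𝒪   : Point A
  aff : (x y : A) → Point A

module Points {c ℓ} (K : Field c ℓ) where
  open Field K

  infix 4 _≈ᴾ_

  data _≈ᴾ_ : Point Carrier → Point Carrier → Set (c ⊔ ℓ) where
    𝒪≈𝒪 : 𝒪 ≈ᴾ 𝒪
    aff≈ : ∀ {x y x′ y′} → x ≈ x′ → y ≈ y′ → aff x y ≈ᴾ aff x′ y′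

  pointSetoid : Setoid c (c ⊔ ℓ)
  pointSetoid = record
    { Carrier       = Point Carrier
    ; _≈_           = _≈ᴾ_
    ; isEquivalence = record { refl = reflᴾ ; sym = symᴾ ; trans = transᴾ }
    }
    where
    reflᴾ : ∀ {P} → P ≈ᴾ P
    reflᴾ {𝒪}       = 𝒪≈𝒪
    reflᴾ {aff _ _} = aff≈ refl refl
    symᴾ : ∀ {P Q} → P ≈ᴾ Q → Q ≈ᴾ P
    symᴾ 𝒪≈𝒪        = 𝒪≈𝒪
    symᴾ (aff≈ p q) = aff≈ (sym p) (sym q)
    transᴾ : ∀ {P Q R} → P ≈ᴾ Q → Q ≈ᴾ R → P ≈ᴾ R
    transᴾ 𝒪≈𝒪        𝒪≈𝒪          = 𝒪≈𝒪
    transᴾ (aff≈ p q) (aff≈ p′ q′) = aff≈ (trans p p′) (trans q q′)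

  frobenius : ℕ → Point Carrier → Point Carrier
  frobenius q 𝒪         = 𝒪
  frobenius q (aff x y) = aff (x ^ q) (y ^ q)

module GroupLaw {c ℓ} (K : Field c ℓ) (W : Weierstrass (Field.Carrier K)) where
  open Field K
  open Weierstrass W
  open Points K

  OnCurve : Pred (Point Carrier) ℓ
  OnCurve 𝒪         = ⊤
  OnCurve (aff x y) =
    y ^ 2 + a₁ * x * y + a₃ * y ≈ x ^ 3 + a₂ * x ^ 2 + a₄ * x + a₆

  negate : Point Carrier → Point Carrier
  negate 𝒪         = 𝒪
  negate (aff x y) = aff x (- y - a₁ * x - a₃)

  -- The sum of two affine points whose chord or tangent is the line of
  -- slope l through (x₁ , y₁): the reflection of its third intersection
  -- with the curve.
  thirdPoint : (l x₁ y₁ x₂ : Carrier) → Point Carrier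
  thirdPoint l x₁ y₁ x₂ = negate (aff x₃ (l * (x₃ - x₁) + y₁))
    where
    x₃ : Carrier
    x₃ = l ^ 2 + a₁ * l - a₂ - x₁ - x₂

  -- Only meaningful on points satisfying OnCurve. If x₁ ≈ x₂, then P₂ is
  -- P₁ or - P₁, and it is - P₁ exactly when y₁ + y₂ + a₁x₁ + a₃ vanishes.
  -- Otherwise y₁ ≈ y₂, and this quantity is the denominator
  -- 2y₁ + a₁x₁ + a₃ of the slope of the tangent.
  add : Point Carrier → Point Carrier → Point Carrier
  add 𝒪           Q           = Q
  add P@(aff _ _) 𝒪           = P
  add (aff x₁ y₁) (aff x₂ y₂) with x₂ - x₁ ≟ 0#
  ... | no x₂-x₁≉0 = thirdPoint (divide (y₂ - y₁) (x₂ - x₁) x₂-x₁≉0) x₁ y₁ x₂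
  ... | yes _ with y₁ + y₂ + a₁ * x₁ + a₃ ≟ 0#
  ...   | yes _  = 𝒪
  ...   | no d≉0 = thirdPoint
    (divide (3 · x₁ ^ 2 + 2 · (a₂ * x₁) + a₄ - a₁ * y₁) (y₁ + y₂ + a₁ * x₁ + a₃) d≉0)
    x₁ y₁ x₂

  rawGroup : RawGroup c (c ⊔ ℓ)
  rawGroup = record
    { Carrier = Point Carrier
    ; _≈_     = _≈ᴾ_
    ; _∙_     = add
    ; ε       = 𝒪
    ; _⁻¹     = negate
    }

  open MonoidMultiples (RawGroup.rawMonoid rawGroup) public
    using () renaming (_×_ to _⋆_)

  record HasOrder (n : ℕ) (P : Point Carrier) : Set (c ⊔ ℓ) where
    field
      positive : 0 ℕ.< n
      kills    : n ⋆ P ≈ᴾ 𝒪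
      minimal  : ∀ m → 0 ℕ.< m → m ℕ.< n → ¬ m ⋆ P ≈ᴾ 𝒪

  record IsSubgroup {p} (G : Pred (Point Carrier) p) : Set (c ⊔ ℓ ⊔ p) where
    field
      onCurve       : G ⊆ OnCurve
      respects      : G Respects _≈ᴾ_
      𝒪-closed      : 𝒪 ∈ G
      add-closed    : ∀ {P Q} → P ∈ G → Q ∈ G → add P Q ∈ G
      negate-closed : ∀ {P} → P ∈ G → negate P ∈ G

  SubgroupHasOrder : ∀ {p} → Pred (Point Carrier) p → ℕ → Set (c ⊔ ℓ ⊔ p)
  SubgroupHasOrder G n = HasCardinality (On.setoid pointSetoid (proj₁ {B = G})) n

  data ⟨_⟩ (P : Point Carrier) : Pred (Point Carrier) (c ⊔ ℓ) where
    generator : P ∈ ⟨ P ⟩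
    identity  : 𝒪 ∈ ⟨ P ⟩
    sum       : ∀ {Q R} → Q ∈ ⟨ P ⟩ → R ∈ ⟨ P ⟩ → add Q R ∈ ⟨ P ⟩
    negative  : ∀ {Q} → Q ∈ ⟨ P ⟩ → negate Q ∈ ⟨ P ⟩
    resp      : ∀ {Q R} → Q ≈ᴾ R → Q ∈ ⟨ P ⟩ → R ∈ ⟨ P ⟩

  FrobeniusStable : ∀ {p} → ℕ → Pred (Point Carrier) p → Set (c ⊔ p)
  FrobeniusStable q G = ∀ {P} → P ∈ G → frobenius q P ∈ G

module _ {c ℓ c′ ℓ′} (F : Field c ℓ) (K : Field c′ ℓ′)
         (ι : Field.Carrier F → Field.Carrier K) where
  open Field K using (Carrier; _≈_)

  DefinedOver : Pred (Point Carrier) (c ⊔ ℓ′)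
  DefinedOver 𝒪         = ⊤
  DefinedOver (aff x y) = ∃₂ λ u v → x ≈ ι u × y ≈ ι v

  module BaseChange (E : EllipticCurve F) where
    open Points K public
    open GroupLaw K (mapWeierstrass ι (EllipticCurve.weierstrass E)) public

{-# OPTIONS --safe #-}

-- A point P = (x, y) of order 3 is an inflection point. In the coordinates
-- X - x = ξ and Y - y = slope · ξ + η, where slope is that of the tangent at P,
-- the curve becomes η² + Aξη + Bη = ξ³ with discriminant B³(A³ - 27B). Since
-- q ≡ 2 mod 3, the field F has characteristic other than 3 and cubing is
-- bijective on it. So A = 3α and B = α³ - ρ³ with α and ρ in F, and ρ ≠ 0 by
-- nonsingularity. With σ = α² + αρ + ρ², two more inflection points are
-- (ξ, η) = (-σ, σ(α - ρω)), for ω either primitive cube root of unity in K.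
-- They are opposite, so together with 𝒪 they form a subgroup. Frobenius swaps
-- them because ω^q = ω², and neither is rational because 1 is the only cube
-- root of unity in F.

module Submission where

open import Defs
open import Algebra.Bundles using (CommutativeMonoid; CommutativeRing)
open import Algebra.Morphism.Structures using (module RingMorphisms)
import Algebra.Properties.CommutativeMonoid.Sum
import Algebra.Properties.CommutativeSemiring.Exp
import Algebra.Properties.Ring
import Algebra.Properties.Semiring.Mult
import Algebra.Properties.Semiring.Mult.TCOptimised
import Algebra.Solver.Ring
open import Algebra.Solver.Ring.AlmostCommutativeRing using (fromCommutativeRing; _-Raw-AlmostCommutative⟶_)
open import Data.Fin.Base using (Fin; zero; suc)
open import Data.Fin.Patterns using (0F; 1F; 2F)
open import Data.Fin.Properties using (0≢1+n; punchInᵢ≢i; suc-injective)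
open import Data.Integer.Base as ℤ using (ℤ; +_; -[1+_])
import Data.Integer.Properties as ℤ
open import Data.List.Base using ([]; _∷_)
open import Data.Maybe.Base using (just; nothing)
open import Data.Nat.Base as ℕ using (ℕ; zero; suc)
open import Data.Nat.Divisibility.Core using (_∣_; quotient)
import Data.Nat.Properties as ℕ
open import Data.Nat.Tactic.RingSolver using (solve-∀)
open import Data.Product.Base using (∃; ∃₂; _×_; _,_; proj₁; proj₂)
open import Data.Sign.Base as Sign using (Sign)
open import Data.Unit.Polymorphic.Base using (tt)
open import Data.Vec.Functional using (removeAt; replicate)
open import Function.Base using (_∘_; const)
open import Function.Bundles using (Inverse)
import Function.Construct.Composition as Composition
import Function.Construct.Symmetry as Symmetry
open import Level using (_⊔_)
open import Relation.Binary.Bundles using (Setoid)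
open import Relation.Binary.Definitions using (WeaklyDecidable)
import Relation.Binary.PropositionalEquality as ≡
open ≡ using (_≡_)
import Relation.Binary.Reasoning.Setoid
open import Relation.Nullary.Decidable.Core using (yes; no)
open import Relation.Nullary.Negation.Core using (¬_; contradiction)
open import Relation.Unary using (Pred; _∈_; _≐_)

-- Ring solver with integer coefficients over a commutative ring.

module IntegerCoefficients {c ℓ} (R : CommutativeRing c ℓ) where
  open CommutativeRing R
  open Algebra.Properties.Ring ring
  open Algebra.Properties.Semiring.Mult.TCOptimised semiring renaming (_×_ to _·_)
  open Relation.Binary.Reasoning.Setoid setoid

  -- With the optimised multiples ⟦ + 1 ⟧ℤ is 1# itself, so con (+ 1) denotes 1#.
  ⟦_⟧ℤ : ℤ → Carrier
  ⟦ + n ⟧ℤ      = n · 1#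
  ⟦ -[1+ n ] ⟧ℤ = - (suc n · 1#)

  ⟦⟧-negate : ∀ i → ⟦ ℤ.- i ⟧ℤ ≈ - ⟦ i ⟧ℤ
  ⟦⟧-negate (+ zero)    = sym -0#≈0#
  ⟦⟧-negate (+ suc n)   = refl
  ⟦⟧-negate (-[1+ n ])  = sym (-‿involutive _)

  suc·1 : ∀ n → suc n · 1# ≈ 1# + n · 1#
  suc·1 n = ×-homo-+ 1# 1 n

  ⟦⟧-⊖ : ∀ m n → ⟦ m ℤ.⊖ n ⟧ℤ ≈ m · 1# - n · 1#
  ⟦⟧-⊖ m       zero    = sym (trans (+-congˡ -0#≈0#) (+-identityʳ _))
  ⟦⟧-⊖ zero    (suc n) = sym (+-identityˡ _)
  ⟦⟧-⊖ (suc m) (suc n) = begin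
    ⟦ suc m ℤ.⊖ suc n ⟧ℤ                  ≡⟨ ≡.cong ⟦_⟧ℤ (ℤ.[1+m]⊖[1+n]≡m⊖n m n) ⟩
    ⟦ m ℤ.⊖ n ⟧ℤ                          ≈⟨ ⟦⟧-⊖ m n ⟩
    m · 1# - n · 1#                       ≈⟨ +-congʳ (xyx⁻¹≈y 1# (m · 1#)) ⟨
    1# + m · 1# - 1# - n · 1#             ≈⟨ +-assoc _ _ _ ⟩
    1# + m · 1# + (- 1# - n · 1#)         ≈⟨ +-congˡ (-‿+-comm 1# (n · 1#)) ⟩
    1# + m · 1# - (1# + n · 1#)           ≈⟨ +-cong (suc·1 m) (-‿cong (suc·1 n)) ⟨
    suc m · 1# - suc n · 1#               ∎

  ⟦⟧-+ : ∀ i j → ⟦ i ℤ.+ j ⟧ℤ ≈ ⟦ i ⟧ℤ + ⟦ j ⟧ℤ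
  ⟦⟧-+ (+ m)    (+ n)    = ×-homo-+ 1# m n
  ⟦⟧-+ (+ m)    -[1+ n ] = ⟦⟧-⊖ m (suc n)
  ⟦⟧-+ -[1+ m ] (+ n)    = trans (⟦⟧-⊖ n (suc m)) (+-comm _ _)
  ⟦⟧-+ -[1+ m ] -[1+ n ] = begin
    - (suc (suc (m ℕ.+ n)) · 1#)     ≡⟨ ≡.cong (λ k → - (k · 1#)) (ℕ.+-suc (suc m) n) ⟨
    - ((suc m ℕ.+ suc n) · 1#)       ≈⟨ -‿cong (×-homo-+ 1# (suc m) (suc n)) ⟩
    - (suc m · 1# + suc n · 1#)      ≈⟨ -‿+-comm _ _ ⟨
    - (suc m · 1#) - (suc n · 1#)    ∎

  ⟦⟧-+◃ : ∀ n → ⟦ Sign.+ ℤ.◃ n ⟧ℤ ≈ n · 1#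
  ⟦⟧-+◃ n = reflexive (≡.cong ⟦_⟧ℤ (ℤ.+◃n≡+n n))

  ⟦⟧--◃ : ∀ n → ⟦ Sign.- ℤ.◃ n ⟧ℤ ≈ - (n · 1#)
  ⟦⟧--◃ n = trans (reflexive (≡.cong ⟦_⟧ℤ (ℤ.-◃n≡-n n))) (⟦⟧-negate (+ n))

  ⟦⟧-* : ∀ i j → ⟦ i ℤ.* j ⟧ℤ ≈ ⟦ i ⟧ℤ * ⟦ j ⟧ℤ
  ⟦⟧-* (+ m)    (+ n)    = trans (⟦⟧-+◃ (m ℕ.* n)) (×1-homo-* m n)
  ⟦⟧-* (+ m)    -[1+ n ] = begin
    ⟦ Sign.- ℤ.◃ (m ℕ.* suc n) ⟧ℤ   ≈⟨ ⟦⟧--◃ (m ℕ.* suc n) ⟩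
    - ((m ℕ.* suc n) · 1#)          ≈⟨ -‿cong (×1-homo-* m (suc n)) ⟩
    - (m · 1# * suc n · 1#)         ≈⟨ -‿distribʳ-* _ _ ⟩
    m · 1# * - (suc n · 1#)         ∎
  ⟦⟧-* -[1+ m ] (+ n)    = begin
    ⟦ Sign.- ℤ.◃ (suc m ℕ.* n) ⟧ℤ   ≈⟨ ⟦⟧--◃ (suc m ℕ.* n) ⟩
    - ((suc m ℕ.* n) · 1#)          ≈⟨ -‿cong (×1-homo-* (suc m) n) ⟩
    - (suc m · 1# * n · 1#)         ≈⟨ -‿distribˡ-* _ _ ⟩
    - (suc m · 1#) * n · 1#         ∎
  ⟦⟧-* -[1+ m ] -[1+ n ] = begin
    (suc m ℕ.* suc n) · 1#             ≈⟨ ×1-homo-* (suc m) (suc n) ⟩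
    suc m · 1# * suc n · 1#            ≈⟨ -‿involutive _ ⟨
    - - (suc m · 1# * suc n · 1#)      ≈⟨ -‿cong (-‿distribʳ-* _ _) ⟩
    - (suc m · 1# * - (suc n · 1#))    ≈⟨ -‿distribˡ-* _ _ ⟩
    - (suc m · 1#) * - (suc n · 1#)    ∎

  morphism : ℤ.+-*-rawRing -Raw-AlmostCommutative⟶ fromCommutativeRing R
  morphism = record
    { ⟦_⟧ = ⟦_⟧ℤ ; +-homo = ⟦⟧-+ ; *-homo = ⟦⟧-* ; -‿homo = ⟦⟧-negate
    ; 0-homo = refl ; 1-homo = refl }

  coefficients≟ : WeaklyDecidable (λ i j → ⟦ i ⟧ℤ ≈ ⟦ j ⟧ℤ)
  coefficients≟ i j with i ℤ.≟ j
  ... | yes i≡j = just (reflexive (≡.cong ⟦_⟧ℤ i≡j))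
  ... | no _    = nothing

  open Algebra.Solver.Ring ℤ.+-*-rawRing (fromCommutativeRing R) morphism coefficients≟ public
    using (con; _:+_; _:*_; _:-_; :-_; _:^_; _:×_; _:=_; solve)

-- Cancellation in fields; polynomial functions and their roots.

module FieldProperties {c ℓ} (K : Field c ℓ) where
  open Field K hiding (zero)
  open IntegerCoefficients commutativeRing
  open Algebra.Properties.Ring ring
  open Relation.Binary.Reasoning.Setoid setoid

  *-cancelˡ-nonZero : ∀ {x y z} → ¬ x ≈ 0# → x * y ≈ x * z → y ≈ z
  *-cancelˡ-nonZero {x} {y} {z} x≉0 xy≈xz with inverse x x≉0
  ... | x⁻¹ , x⁻¹x≈1 , _ = begin
    y              ≈⟨ *-identityˡ y ⟨
    1# * y         ≈⟨ *-congʳ x⁻¹x≈1 ⟨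
    x⁻¹ * x * y    ≈⟨ *-assoc _ _ _ ⟩
    x⁻¹ * (x * y)  ≈⟨ *-congˡ xy≈xz ⟩
    x⁻¹ * (x * z)  ≈⟨ *-assoc _ _ _ ⟨
    x⁻¹ * x * z    ≈⟨ *-congʳ x⁻¹x≈1 ⟩
    1# * z         ≈⟨ *-identityˡ z ⟩
    z              ∎

  x*y≈0⇒y≈0 : ∀ {x y} → ¬ x ≈ 0# → x * y ≈ 0# → y ≈ 0#
  x*y≈0⇒y≈0 {x} x≉0 xy≈0 = *-cancelˡ-nonZero x≉0 (trans xy≈0 (sym (zeroʳ x)))

  *-nonZero : ∀ {x y} → ¬ x ≈ 0# → ¬ y ≈ 0# → ¬ x * y ≈ 0#
  *-nonZero x≉0 y≉0 xy≈0 = y≉0 (x*y≈0⇒y≈0 x≉0 xy≈0)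

  *-divide : ∀ x y (y≉0 : ¬ y ≈ 0#) → y * divide x y y≉0 ≈ x
  *-divide x y y≉0 with inverse y y≉0
  ... | y⁻¹ , _ , yy⁻¹≈1 = begin
    y * (x * y⁻¹)  ≈⟨ solve 3 (λ y x i → y :* (x :* i) := x :* (y :* i)) refl y x y⁻¹ ⟩
    x * (y * y⁻¹)  ≈⟨ *-congˡ yy⁻¹≈1 ⟩
    x * 1#         ≈⟨ *-identityʳ x ⟩
    x              ∎

  x≈y⇒x-y≈0 : ∀ {x y} → x ≈ y → x - y ≈ 0#
  x≈y⇒x-y≈0 {y = y} x≈y = trans (+-congʳ x≈y) (-‿inverseʳ y)

  x-y≈0⇒x≈y : ∀ {x y} → x - y ≈ 0# → x ≈ y
  x-y≈0⇒x≈y {x} {y} eq = begin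
    x          ≈⟨ solve 2 (λ x y → x := (x :- y) :+ y) refl x y ⟩
    x - y + y  ≈⟨ +-congʳ eq ⟩
    0# + y     ≈⟨ +-identityˡ y ⟩
    y          ∎

  -- Polynomial functions of degree less than `n`, in Horner form. The leading coefficient may
  -- vanish, so the class is closed under addition.
  Polynomial< : ℕ → (Carrier → Carrier) → Set (c ⊔ ℓ)
  Polynomial< zero    f = ∀ x → f x ≈ 0#
  Polynomial< (suc n) f = ∃₂ λ a g → Polynomial< n g × (∀ x → f x ≈ a + x * g x)

  Polynomial<-resp : ∀ n {f g} → (∀ x → g x ≈ f x) → Polynomial< n f → Polynomial< n g
  Polynomial<-resp zero    g≈f f≈0             = λ x → trans (g≈f x) (f≈0 x)
  Polynomial<-resp (suc n) g≈f (a , h , p , e) = a , h , p , λ x → trans (g≈f x) (e x)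

  Polynomial<-suc : ∀ n {f} → Polynomial< n f → Polynomial< (suc n) f
  Polynomial<-suc zero    {f} f≈0 = 0# , f , f≈0 , λ x →
    trans (f≈0 x) (sym (trans (+-identityˡ _) (trans (*-congˡ (f≈0 x)) (zeroʳ x))))
  Polynomial<-suc (suc n) (a , g , p , e) = a , g , Polynomial<-suc n p , e

  Polynomial<-+ : ∀ n {f g} → Polynomial< n f → Polynomial< n g → Polynomial< n (λ x → f x + g x)
  Polynomial<-+ zero    f≈0 g≈0 x = trans (+-cong (f≈0 x) (g≈0 x)) (+-identityˡ 0#)
  Polynomial<-+ (suc n) (a , f′ , p , e) (b , g′ , p′ , e′) =
    a + b , (λ x → f′ x + g′ x) , Polynomial<-+ n p p′ , λ x → trans (+-cong (e x) (e′ x))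
      (solve 5 (λ a b x u v → a :+ x :* u :+ (b :+ x :* v) := a :+ b :+ x :* (u :+ v))
        refl a b x (f′ x) (g′ x))

  Polynomial<-scale : ∀ n b {f} → Polynomial< n f → Polynomial< n (λ x → b * f x)
  Polynomial<-scale zero    b f≈0 x = trans (*-congˡ (f≈0 x)) (zeroʳ b)
  Polynomial<-scale (suc n) b (a , g , p , e) =
    b * a , (λ x → b * g x) , Polynomial<-scale n b p , λ x → trans (*-congˡ (e x))
      (solve 4 (λ b a x u → b :* (a :+ x :* u) := b :* a :+ x :* (b :* u)) refl b a x (g x))

  Polynomial<-shift : ∀ n {f} → Polynomial< n f → Polynomial< (suc n) (λ x → x * f x)
  Polynomial<-shift n {f} p = 0# , f , p , λ x → sym (+-identityˡ _)

  Polynomial<-const : ∀ n a → Polynomial< (suc n) (const a)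
  Polynomial<-const zero    a = a , const 0# , (λ _ → refl) , λ x →
    sym (trans (+-congˡ (zeroʳ x)) (+-identityʳ a))
  Polynomial<-const (suc n) a = Polynomial<-suc (suc n) (Polynomial<-const n a)

  Polynomial<-[x+b]^ : ∀ n b → Polynomial< (suc n) (λ x → (x + b) ^ n)
  Polynomial<-[x+b]^ zero    b = Polynomial<-const zero 1#
  Polynomial<-[x+b]^ (suc n) b = Polynomial<-resp (suc (suc n)) (λ x → distribʳ _ x b)
    (Polynomial<-+ (suc (suc n)) (Polynomial<-shift (suc n) (Polynomial<-[x+b]^ n b))
      (Polynomial<-suc (suc n) (Polynomial<-scale (suc n) b (Polynomial<-[x+b]^ n b))))

  -- The leading terms cancel. With u and v the n-th powers of x + b and x, the induction uses (x +
  -- b)u - xv = x(u - v) + bu.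
  Polynomial<-[x+b]^-x^ : ∀ n b → Polynomial< n (λ x → (x + b) ^ n - x ^ n)
  Polynomial<-[x+b]^-x^ zero    b = λ x → -‿inverseʳ 1#
  Polynomial<-[x+b]^-x^ (suc n) b = Polynomial<-resp (suc n)
    (λ x → solve 4 (λ x b u v → (x :+ b) :* u :- x :* v := x :* (u :- v) :+ b :* u)
      refl x b ((x + b) ^ n) (x ^ n))
    (Polynomial<-+ (suc n) (Polynomial<-shift n (Polynomial<-[x+b]^-x^ n b))
      (Polynomial<-scale (suc n) b (Polynomial<-[x+b]^ n b)))

  -- Horner division by `x - r` with remainder `f r`: if `h` is the quotient for `g`, then
  -- `g r + x * h x` is the quotient for `a + x * g x`.
  factor : ∀ n {f} r → Polynomial< (suc n) f →
    ∃ λ g → Polynomial< n g × (∀ x → f x ≈ f r + (x - r) * g x)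
  factor zero {f} r (a , g , g≈0 , e) = g , g≈0 , λ x → begin
    f x                      ≈⟨ f≈a x ⟩
    a                        ≈⟨ f≈a r ⟨
    f r                      ≈⟨ +-identityʳ _ ⟨
    f r + 0#                 ≈⟨ +-congˡ (zeroʳ (x - r)) ⟨
    f r + (x - r) * 0#       ≈⟨ +-congˡ (*-congˡ (g≈0 x)) ⟨
    f r + (x - r) * g x      ∎
    where
    f≈a : ∀ x → f x ≈ a
    f≈a x = trans (e x) (trans (+-congˡ (trans (*-congˡ (g≈0 x)) (zeroʳ x))) (+-identityʳ a))
  factor (suc n) {f} r (a , g , p , e) with factor n r p
  ... | h , p′ , e′ = (λ x → g r + x * h x) , (g r , h , p′ , λ x → refl) , λ x → begin
    f x                                      ≈⟨ e x ⟩
    a + x * g x                              ≈⟨ +-congˡ (*-congˡ (e′ x)) ⟩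
    a + x * (g r + (x - r) * h x)            ≈⟨ solve 5 (λ a x r u v →
      a :+ x :* (u :+ (x :- r) :* v) := a :+ r :* u :+ (x :- r) :* (u :+ x :* v)) refl a x r (g r) (h x) ⟩
    a + r * g r + (x - r) * (g r + x * h x)  ≈⟨ +-congʳ (e r) ⟨
    f r + (x - r) * (g r + x * h x)          ∎

  -- The linear factor split off at one root is nonzero at the others, so the quotient inherits
  -- those while its degree bound drops. When the roots are used up, the bound is 0.
  vanishes : ∀ n {f} → Polynomial< n f → (r : Fin n → Carrier) → (∀ {i j} → r i ≈ r j → i ≡ j) →
    (∀ i → f (r i) ≈ 0#) → ∀ x → f x ≈ 0#
  vanishes zero    f≈0 _ _ _ = f≈0
  vanishes (suc n) {f} p r r-injective f[r]≈0 x with factor n (r zero) p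
  ... | g , p′ , e = trans (f≈ x) (trans (*-congˡ (g≈0 x)) (zeroʳ _))
    where
    f≈ : ∀ x → f x ≈ (x - r zero) * g x
    f≈ x = trans (e x) (trans (+-congʳ (f[r]≈0 zero)) (+-identityˡ _))
    g≈0 : ∀ x → g x ≈ 0#
    g≈0 = vanishes n p′ (r ∘ suc) (suc-injective ∘ r-injective) λ i →
      x*y≈0⇒y≈0 (λ eq → 0≢1+n (≡.sym (r-injective (x-y≈0⇒x≈y eq))))
        (trans (sym (f≈ (r (suc i)))) (f[r]≈0 (suc i)))

-- Reindexing sums over a finite setoid.

module _ {a b c ℓ n} (M : CommutativeMonoid a b) (S : Setoid c ℓ) (S-finite : HasCardinality S n) where
  open CommutativeMonoid M
  open Algebra.Properties.CommutativeMonoid.Sum M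
  open Inverse S-finite using (from; to; strictlyInverseʳ)

  -- Conjugation by the enumeration turns `φ` into a permutation of `Fin n`. The monoid is a
  -- parameter because both sums and products over a finite field get reindexed.
  sum-reindex : (φ : Inverse S S) (f : Setoid.Carrier S → Carrier) →
    (∀ {x y} → Setoid._≈_ S x y → f x ≈ f y) →
    sum (f ∘ from) ≈ sum (f ∘ Inverse.to φ ∘ from)
  sum-reindex φ f f-cong = trans
    (sum-permute (f ∘ from)
      (Composition.inverse (Composition.inverse (Symmetry.inverse S-finite) φ) S-finite))
    (sum-cong-≋ λ i → f-cong (strictlyInverseʳ (Inverse.to φ (from i))))

-- Characteristic and Fermat's little theorem in a finite field.

module FiniteField {c ℓ} (F : Field c ℓ) {q} (F-finite : HasCardinality (Field.setoid F) q) where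
  open Field F hiding (zero)
  open FieldProperties F
  open IntegerCoefficients commutativeRing
  open Algebra.Properties.Ring ring
  open Algebra.Properties.CommutativeSemiring.Exp commutativeSemiring using (^-congˡ)
  open Relation.Binary.Reasoning.Setoid setoid
  open Inverse F-finite using (from; to; to-cong; strictlyInverseˡ; strictlyInverseʳ)

  private
    module + = Algebra.Properties.CommutativeMonoid.Sum +-commutativeMonoid
    module * = Algebra.Properties.CommutativeMonoid.Sum *-commutativeMonoid

  -- Comparing the sum of all x with the sum of all x + 1.
  q·1≈0 : q · 1# ≈ 0#
  q·1≈0 = +-cancelˡ (+.sum from) _ _ (begin
    +.sum from + q · 1#                 ≈⟨ +-congˡ (+.sum-replicate q) ⟨
    +.sum from + +.sum {q} (replicate q 1#)
      ≈⟨ +.∑-distrib-+ from (replicate q 1#) ⟨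
    +.sum (λ i → from i + 1#)
      ≈⟨ sum-reindex +-commutativeMonoid setoid F-finite translation (λ x → x) (λ eq → eq) ⟨
    +.sum from                          ≈⟨ +-identityʳ _ ⟨
    +.sum from + 0#                     ∎)
    where
    translation : Inverse setoid setoid
    translation = record
      { to = _+ 1# ; from = _- 1# ; to-cong = +-congʳ ; from-cong = +-congʳ
      ; inverse = (λ {x} {y} y≈x-1 → trans (+-congʳ y≈x-1)
                    (solve 2 (λ x e → x :- e :+ e := x) refl x 1#))
                , (λ {x} {y} y≈x+1 → trans (+-congʳ y≈x+1)
                    (solve 2 (λ x e → x :+ e :- e := x) refl x 1#)) }

  product-nonZero : ∀ n (f : Fin n → Carrier) → (∀ i → ¬ f i ≈ 0#) → ¬ *.sum f ≈ 0#
  product-nonZero zero    f f≉0 = 1≉0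
  product-nonZero (suc n) f f≉0 = *-nonZero (f≉0 zero) (product-nonZero n (f ∘ suc) (f≉0 ∘ suc))

  _orAt0_ : (Carrier → Carrier) → Carrier → Carrier → Carrier
  (f orAt0 e) x with x ≟ 0#
  ... | yes _ = e
  ... | no _  = f x

  orAt0-0 : ∀ f {e x} → x ≈ 0# → (f orAt0 e) x ≡ e
  orAt0-0 f {x = x} x≈0 with x ≟ 0#
  ... | yes _  = ≡.refl
  ... | no x≉0 = contradiction x≈0 x≉0

  orAt0-≉0 : ∀ f {e x} → ¬ x ≈ 0# → (f orAt0 e) x ≡ f x
  orAt0-≉0 f {x = x} x≉0 with x ≟ 0#
  ... | yes x≈0 = contradiction x≈0 x≉0
  ... | no _    = ≡.refl

  -- Multiplication by a permutes the nonzero elements. So that products can run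
  -- over all of F, the element 0 is made to contribute the factor 1.
  module _ (a : Carrier) (a≉0 : ¬ a ≈ 0#) where
    private
      unit scale : Carrier → Carrier
      unit  = (λ x → x) orAt0 1#
      scale = const a orAt0 1#

      unit-cong : ∀ {x y} → x ≈ y → unit x ≈ unit y
      unit-cong {x} {y} x≈y with x ≟ 0# | y ≟ 0#
      ... | yes _   | yes _   = refl
      ... | no _    | no _    = x≈y
      ... | yes x≈0 | no y≉0  = contradiction (trans (sym x≈y) x≈0) y≉0
      ... | no x≉0  | yes y≈0 = contradiction (trans x≈y y≈0) x≉0

      unit≉0 : ∀ x → ¬ unit x ≈ 0#
      unit≉0 x with x ≟ 0#
      ... | yes _  = 1≉0
      ... | no x≉0 = x≉0

      unit-homothety : ∀ x → unit (a * x) ≈ scale x * unit x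
      unit-homothety x with x ≟ 0#
      ... | yes x≈0 = trans (reflexive (orAt0-0 (λ x → x) (trans (*-congˡ x≈0) (zeroʳ a))))
                            (sym (*-identityˡ 1#))
      ... | no x≉0  = reflexive (orAt0-≉0 (λ x → x) (*-nonZero a≉0 x≉0))

      homothety : Inverse setoid setoid
      homothety with inverse a a≉0
      ... | a⁻¹ , a⁻¹a≈1 , aa⁻¹≈1 = record
        { to = a *_ ; from = a⁻¹ *_ ; to-cong = *-congˡ ; from-cong = *-congˡ
        ; inverse = (λ {x} y≈a⁻¹x → trans (*-congˡ y≈a⁻¹x) (cancel aa⁻¹≈1 x))
                  , (λ {x} y≈ax → trans (*-congˡ y≈ax) (cancel a⁻¹a≈1 x)) }
        where
        cancel : ∀ {u v} → u * v ≈ 1# → ∀ x → u * (v * x) ≈ x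
        cancel uv≈1 x = trans (sym (*-assoc _ _ x)) (trans (*-congʳ uv≈1) (*-identityˡ x))

      -- Reindexing by `homothety` preserves the product of all `unit x`, yet multiplies it by the
      -- product of all `scale x`. The former is nonzero and cancels.
      ∏scale≈1 : *.sum (scale ∘ from) ≈ 1#
      ∏scale≈1 = *-cancelˡ-nonZero (product-nonZero q (unit ∘ from) (unit≉0 ∘ from)) (begin
        ∏unit * *.sum (scale ∘ from)              ≈⟨ *-comm _ _ ⟩
        *.sum (scale ∘ from) * ∏unit              ≈⟨ *.∑-distrib-+ (scale ∘ from) (unit ∘ from) ⟨
        *.sum (λ i → scale (from i) * unit (from i))
          ≈⟨ *.sum-cong-≋ (unit-homothety ∘ from) ⟨
        *.sum (λ i → unit (a * from i))
          ≈⟨ sum-reindex *-commutativeMonoid setoid F-finite homothety unit unit-cong ⟨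
        ∏unit                                     ≈⟨ *-identityʳ _ ⟨
        ∏unit * 1#                                ∎)
        where ∏unit = *.sum (unit ∘ from)

    -- Every element except 0 contributes `a` to the product of all `scale x`, which is thus the
    -- power of `a` with exponent q - 1. One more factor `a` avoids the subtraction.
    fermat-≉0 : a ^ q ≈ a
    fermat-≉0 = go q from (to 0#) (strictlyInverseʳ 0#)
      (λ i≢ eq → i≢ (≡.trans (≡.sym (strictlyInverseˡ _)) (to-cong eq))) ∏scale≈1
      where
      -- With `q` generalised to `n`, the index `i` of 0 forces `n` to be a successor and marks the
      -- factor to remove.
      go : ∀ n (r : Fin n → Carrier) i → r i ≈ 0# → (∀ {j} → ¬ j ≡ i → ¬ r j ≈ 0#) →
           *.sum (scale ∘ r) ≈ 1# → a ^ n ≈ a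
      go (suc n) r i rᵢ≈0 r≉0 ∏≈1 = begin
        a * a ^ n                                ≈⟨ *-congˡ (*.sum-replicate n) ⟨
        a * *.sum (replicate n a)                ≈⟨ *-congˡ (*.sum-cong-≋ λ j →
          reflexive (orAt0-≉0 (const a) (r≉0 (punchInᵢ≢i i j)))) ⟨
        a * *.sum (removeAt (scale ∘ r) i)       ≈⟨ *-congˡ (*-identityˡ _) ⟨
        a * (1# * *.sum (removeAt (scale ∘ r) i))
          ≈⟨ *-congˡ (*-congʳ (reflexive (orAt0-0 (const a) rᵢ≈0))) ⟨
        a * (scale (r i) * *.sum (removeAt (scale ∘ r) i))
          ≈⟨ *-congˡ (*.sum-remove (scale ∘ r)) ⟨
        a * *.sum (scale ∘ r)                    ≈⟨ *-congˡ ∏≈1 ⟩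
        a * 1#                                   ≈⟨ *-identityʳ a ⟩
        a                                        ∎

  0^q≈0 : 0# ^ q ≈ 0#
  0^q≈0 = go q (to 0#)
    where
    go : ∀ n → Fin n → 0# ^ n ≈ 0#
    go (suc n) _ = zeroˡ _

  fermat : ∀ a → a ^ q ≈ a
  fermat a with a ≟ 0#
  ... | yes a≈0 = trans (^-congˡ q a≈0) (trans 0^q≈0 (sym a≈0))
  ... | no a≉0  = fermat-≉0 a a≉0

-- The embedding of the base field and its rational elements.

module FieldHomomorphism {c ℓ c′ ℓ′} (F : Field c ℓ) (K : Field c′ ℓ′)
  (ι : Field.Carrier F → Field.Carrier K)
  (ι-hom : RingMorphisms.IsRingHomomorphism (Field.rawRing F) (Field.rawRing K) ι) where
  private
    module F = Field F
    module F′ = FieldProperties F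
  open Field K hiding (zero)
  open FieldProperties K
  open Relation.Binary.Reasoning.Setoid setoid
  open RingMorphisms.IsRingHomomorphism ι-hom public
    using (+-homo; *-homo; -‿homo; 0#-homo; 1#-homo) renaming (⟦⟧-cong to ι-cong)

  sub-homo : ∀ u v → ι (u F.- v) ≈ ι u - ι v
  sub-homo u v = trans (+-homo u (F.- v)) (+-congˡ (-‿homo v))

  ·-homo : ∀ n u → ι (n F.· u) ≈ n · ι u
  ·-homo zero    u = 0#-homo
  ·-homo (suc n) u = trans (+-homo u (n F.· u)) (+-congˡ (·-homo n u))

  ^-homo : ∀ n u → ι (u F.^ n) ≈ ι u ^ n
  ^-homo zero    u = 1#-homo
  ^-homo (suc n) u = trans (*-homo u (u F.^ n)) (*-congˡ (^-homo n u))

  ι≉0 : ∀ {u} → ¬ u F.≈ F.0# → ¬ ι u ≈ 0#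
  ι≉0 {u} u≉0 ιu≈0 with F.inverse u u≉0
  ... | v , vu≈1 , _ = 1≉0 (begin
    1#            ≈⟨ 1#-homo ⟨
    ι F.1#        ≈⟨ ι-cong vu≈1 ⟨
    ι (v F.* u)   ≈⟨ *-homo v u ⟩
    ι v * ι u     ≈⟨ *-congˡ ιu≈0 ⟩
    ι v * 0#      ≈⟨ zeroʳ _ ⟩
    0#            ∎)

  ι-injective : ∀ {u v} → ι u ≈ ι v → u F.≈ v
  ι-injective {u} {v} ιu≈ιv with (u F.- v) F.≟ F.0#
  ... | yes u-v≈0 = F′.x-y≈0⇒x≈y u-v≈0
  ... | no u-v≉0  = contradiction (trans (sub-homo u v) (x≈y⇒x-y≈0 ιu≈ιv)) (ι≉0 u-v≉0)

  Rational : Carrier → Set (c ⊔ ℓ′)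
  Rational z = ∃ λ u → z ≈ ι u

  +-rational : ∀ {y z} → Rational y → Rational z → Rational (y + z)
  +-rational (u , y≈) (v , z≈) = u F.+ v , trans (+-cong y≈ z≈) (sym (+-homo u v))

  *-rational : ∀ {y z} → Rational y → Rational z → Rational (y * z)
  *-rational (u , y≈) (v , z≈) = u F.* v , trans (*-cong y≈ z≈) (sym (*-homo u v))

  neg-rational : ∀ {z} → Rational z → Rational (- z)
  neg-rational (u , z≈) = F.- u , trans (-‿cong z≈) (sym (-‿homo u))

  sub-rational : ∀ {y z} → Rational y → Rational z → Rational (y - z)
  sub-rational y z = +-rational y (neg-rational z)

  0-rational : Rational 0#
  0-rational = F.0# , sym 0#-homo

  1-rational : Rational 1#
  1-rational = F.1# , sym 1#-homo

  ·-rational : ∀ n {z} → Rational z → Rational (n · z)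
  ·-rational zero    _ = 0-rational
  ·-rational (suc n) z = +-rational z (·-rational n z)

  ^-rational : ∀ n {z} → Rational z → Rational (z ^ n)
  ^-rational zero    _ = 1-rational
  ^-rational (suc n) z = *-rational z (^-rational n z)

  -- Division in `F` yields a solution of the linear equation, and `d` nonzero makes it unique. The
  -- equation form fits slopes, `α` and `ω`, which all arise as such solutions.
  quotient-rational : ∀ {d n z} → ¬ d ≈ 0# → d * z ≈ n → Rational d → Rational n → Rational z
  quotient-rational {d} {n} {z} d≉0 dz≈n (u , d≈ιu) (v , n≈ιv) =
    F.divide v u u≉0 , *-cancelˡ-nonZero d≉0 (begin
      d * z                       ≈⟨ dz≈n ⟩
      n                           ≈⟨ n≈ιv ⟩
      ι v                         ≈⟨ ι-cong (F′.*-divide v u u≉0) ⟨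
      ι (u F.* F.divide v u u≉0)  ≈⟨ *-homo u _ ⟩
      ι u * ι (F.divide v u u≉0)  ≈⟨ *-congʳ d≈ιu ⟨
      d * ι (F.divide v u u≉0)    ∎)
    where
    u≉0 : ¬ u F.≈ F.0#
    u≉0 u≈0 = d≉0 (trans d≈ιu (trans (ι-cong u≈0) 0#-homo))

-- The q-power Frobenius, and cubing when 3 divides q + 1.

module Frobenius {c ℓ c′ ℓ′} (F : Field c ℓ) {q} (F-finite : HasCardinality (Field.setoid F) q)
  (K : Field c′ ℓ′) (ι : Field.Carrier F → Field.Carrier K)
  (ι-hom : RingMorphisms.IsRingHomomorphism (Field.rawRing F) (Field.rawRing K) ι) where
  private
    module F = Field F
    module F* = FiniteField F F-finite
  open Field K hiding (zero)
  open FieldProperties K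
  open FieldHomomorphism F K ι ι-hom
  open IntegerCoefficients commutativeRing
  open Algebra.Properties.CommutativeSemiring.Exp commutativeSemiring using (^-congˡ; ^-congʳ; ^-homo-*; ^-assocʳ)
  open Algebra.Properties.Semiring.Mult semiring using (×-homo-+; ×-assocˡ; ×-congˡ; ×-congʳ)
  open Relation.Binary.Reasoning.Setoid setoid
  open Inverse F-finite using (from; to; to-cong; strictlyInverseˡ)

  ^q-rational : ∀ {z} → Rational z → z ^ q ≈ z
  ^q-rational {z} (u , z≈ιu) = begin
    z ^ q        ≈⟨ ^-congˡ q z≈ιu ⟩
    ι u ^ q      ≈⟨ ^-homo q u ⟨
    ι (u F.^ q)  ≈⟨ ι-cong (F*.fermat u) ⟩
    ι u          ≈⟨ z≈ιu ⟨
    z            ∎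

  -- (z + b)^q - z^q - b has degree less than q in z and vanishes on F.
  [z+b]^q≈z^q+b : ∀ {b} → Rational b → ∀ z → (z + b) ^ q ≈ z ^ q + b
  [z+b]^q≈z^q+b {b} b-rational z = x-y≈0⇒x≈y (begin
    (z + b) ^ q - (z ^ q + b)
      ≈⟨ solve 3 (λ u v b → u :- (v :+ b) := u :- v :- b) refl ((z + b) ^ q) (z ^ q) b ⟩
    (z + b) ^ q - z ^ q - b
      ≈⟨ vanishes q defect (λ i → ι (from i)) ι∘from-injective defect-rational z ⟩
    0# ∎)
    where
    -- A constant has degree less than `q` only if `q` is positive; the index of `F.0#` witnesses
    -- this.
    const-q : ∀ n → Fin n → Polynomial< n (λ _ → - b)
    const-q (suc n) _ = Polynomial<-const n (- b)

    defect : Polynomial< q (λ z → (z + b) ^ q - z ^ q - b)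
    defect = Polynomial<-+ q (Polynomial<-[x+b]^-x^ q b) (const-q q (to F.0#))

    ι∘from-injective : ∀ {i j} → ι (from i) ≈ ι (from j) → i ≡ j
    ι∘from-injective {i} {j} eq =
      ≡.trans (≡.sym (strictlyInverseˡ i)) (≡.trans (to-cong (ι-injective eq)) (strictlyInverseˡ j))

    defect-rational : ∀ i → (ι (from i) + b) ^ q - ι (from i) ^ q - b ≈ 0#
    defect-rational i = begin
      (x + b) ^ q - x ^ q - b
        ≈⟨ +-congʳ (+-cong (^q-rational (+-rational x-rational b-rational))
                           (-‿cong (^q-rational x-rational))) ⟩
      x + b - x - b
        ≈⟨ solve 2 (λ x b → x :+ b :- x :- b := con (+ 0)) refl x b ⟩
      0# ∎
      where
      x = ι (from i)
      x-rational : Rational x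
      x-rational = from i , refl

  1^n≈1 : ∀ n → 1# ^ n ≈ 1#
  1^n≈1 zero    = refl
  1^n≈1 (suc n) = trans (*-identityˡ _) (1^n≈1 n)

  module _ (3∣q+1 : 3 ∣ q ℕ.+ 1) where
    private
      k : ℕ
      k = quotient 3∣q+1

      q+1≡k*3 : q ℕ.+ 1 ≡ k ℕ.* 3
      q+1≡k*3 = _∣_.equality 3∣q+1

    -- If 3 vanished, then both q and its successor, a multiple of 3, would vanish in `K`, and so
    -- would their difference 1.
    3≉0 : ¬ 3 · 1# ≈ 0#
    3≉0 3≈0 = 1≉0 (begin
      1#                 ≈⟨ solve 0 (con (+ 1) := 1 :× con (+ 1)) refl ⟩
      1 · 1#             ≈⟨ +-identityˡ _ ⟨
      0# + 1 · 1#        ≈⟨ +-congʳ (trans (ι-cong F*.q·1≈0) 0#-homo) ⟨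
      ι (q F.· F.1#) + 1 · 1#  ≈⟨ +-congʳ (trans (·-homo q F.1#) (×-congʳ q 1#-homo)) ⟩
      q · 1# + 1 · 1#    ≈⟨ ×-homo-+ 1# q 1 ⟨
      (q ℕ.+ 1) · 1#     ≈⟨ ×-congˡ q+1≡k*3 ⟩
      (k ℕ.* 3) · 1#     ≈⟨ ×-assocˡ 1# k 3 ⟨
      k · 3 · 1#         ≈⟨ ×-congʳ k 3≈0 ⟩
      k · 0#             ≈⟨ n·0≈0 k ⟩
      0#                 ∎)
      where
      n·0≈0 : ∀ n → n · 0# ≈ 0#
      n·0≈0 zero    = refl
      n·0≈0 (suc n) = trans (+-identityˡ _) (n·0≈0 n)

    -- With q = 3j + 2, an inverse e of 3 modulo q - 1 is 2j + 1.
    cubing-inverse : ∃ λ e → ∀ {z} → Rational z → z ^ (e ℕ.* 3) ≈ z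
    cubing-inverse = go k q+1≡k*3
      where
      go : ∀ k → q ℕ.+ 1 ≡ k ℕ.* 3 → ∃ λ e → ∀ {z} → Rational z → z ^ (e ℕ.* 3) ≈ z
      go zero    q+1≡0 = contradiction (≡.trans (ℕ.+-comm 1 q) q+1≡0) λ()
      go (suc j) q+1≡  = suc (2 ℕ.* j) , λ {z} z-rational → begin
        z ^ (suc (2 ℕ.* j) ℕ.* 3)      ≡⟨ ≡.cong (z ^_) exponent ⟩
        z ^ (q ℕ.+ suc (j ℕ.* 3))      ≈⟨ ^-homo-* z q (suc (j ℕ.* 3)) ⟩
        z ^ q * z ^ suc (j ℕ.* 3)      ≈⟨ *-congʳ (^q-rational z-rational) ⟩
        z ^ suc (suc (j ℕ.* 3))        ≡⟨ ≡.cong (z ^_) q≡ ⟨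
        z ^ q                          ≈⟨ ^q-rational z-rational ⟩
        z                              ∎
        where
        q≡ : q ≡ suc (suc (j ℕ.* 3))
        q≡ = ℕ.suc-injective (≡.trans (ℕ.+-comm 1 q) q+1≡)
        identity : ∀ j → suc (2 ℕ.* j) ℕ.* 3 ≡ suc (suc (j ℕ.* 3)) ℕ.+ suc (j ℕ.* 3)
        identity = solve-∀
        exponent : suc (2 ℕ.* j) ℕ.* 3 ≡ q ℕ.+ suc (j ℕ.* 3)
        exponent = ≡.trans (identity j) (≡.cong (ℕ._+ suc (j ℕ.* 3)) (≡.sym q≡))

    -- Raising to the power `e` undoes cubing on rational elements, and a power of `z` is again
    -- rational.
    cubeRoot : ∀ {z} → Rational z → ∃ λ r → Rational r × r ^ 3 ≈ z
    cubeRoot {z} z-rational with cubing-inverse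
    ... | e , z^[e*3]≈z = z ^ e , ^-rational e z-rational , trans (^-assocʳ z e 3) (z^[e*3]≈z z-rational)

    -- The power `e` recovers `z` from its cube, and sends 1 to 1.
    z³≈1⇒z≈1 : ∀ {z} → Rational z → z ^ 3 ≈ 1# → z ≈ 1#
    z³≈1⇒z≈1 {z} z-rational z³≈1 with cubing-inverse
    ... | e , z^[e*3]≈z = begin
      z              ≈⟨ z^[e*3]≈z z-rational ⟨
      z ^ (e ℕ.* 3)  ≈⟨ ^-congʳ z (ℕ.*-comm e 3) ⟩
      z ^ (3 ℕ.* e)  ≈⟨ ^-assocʳ z 3 e ⟨
      (z ^ 3) ^ e    ≈⟨ ^-congˡ e z³≈1 ⟩
      1# ^ e         ≈⟨ 1^n≈1 e ⟩
      1#             ∎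

    -- The exponent q + 1 is a multiple of 3. Hence Frobenius inverts cube roots of unity, rational
    -- or not.
    z³≈1⇒z*z^q≈1 : ∀ {z} → z ^ 3 ≈ 1# → z * z ^ q ≈ 1#
    z³≈1⇒z*z^q≈1 {z} z³≈1 = begin
      z ^ suc q      ≈⟨ ^-congʳ z (≡.trans (ℕ.+-comm 1 q) (≡.trans q+1≡k*3 (ℕ.*-comm k 3))) ⟩
      z ^ (3 ℕ.* k)  ≈⟨ ^-assocʳ z 3 k ⟨
      (z ^ 3) ^ k    ≈⟨ ^-congˡ k z³≈1 ⟩
      1# ^ k         ≈⟨ 1^n≈1 k ⟩
      1#             ∎

-- The group law at inflection points.

module WeierstrassCurve {c ℓ} (K : Field c ℓ) (W : Weierstrass (Field.Carrier K)) where
  open Field K hiding (zero)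
  open Weierstrass W
  open Points K
  open GroupLaw K W
  open FieldProperties K
  open IntegerCoefficients commutativeRing
  open Algebra.Properties.CommutativeSemiring.Exp commutativeSemiring using (^-congˡ)
  open Algebra.Properties.Semiring.Mult semiring using (×-congʳ)
  open Relation.Binary.Reasoning.Setoid setoid

  infixl 6 _⊕_
  infix 7 _⊛_

  -- Equations u ≈ v are derived by writing u - v as a linear combination of
  -- quantities that vanish.
  _⊕_ : ∀ {u v} → u ≈ 0# → v ≈ 0# → u + v ≈ 0#
  u≈0 ⊕ v≈0 = trans (+-cong u≈0 v≈0) (+-identityˡ 0#)

  _⊛_ : ∀ a {u} → u ≈ 0# → a * u ≈ 0#
  a ⊛ u≈0 = trans (*-congˡ u≈0) (zeroʳ a)

  sub-cong : ∀ {u v u′ v′} → u ≈ u′ → v ≈ v′ → u - v ≈ u′ - v′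
  sub-cong u≈ v≈ = +-cong u≈ (-‿cong v≈)

  -- The partial derivatives of y² + a₁xy + a₃y - (x³ + a₂x² + a₄x + a₆), the one
  -- in x negated.
  ∂y : Carrier → Carrier → Carrier
  ∂y x y = y + y + a₁ * x + a₃

  -∂x : Carrier → Carrier → Carrier
  -∂x x y = 3 · x ^ 2 + 2 · (a₂ * x) + a₄ - a₁ * y

  -- The tangent is not vertical, and `meets` puts its third intersection back at abscissa `x`. The
  -- slope is specified by a product, since `divide` would tie it to a particular proof of
  -- nonvanishing.
  record Inflection (x y : Carrier) : Set (c ⊔ ℓ) where
    field
      onCurve  : OnCurve (aff x y)
      ∂y≉0     : ¬ ∂y x y ≈ 0#
      slope    : Carrier
      tangent  : ∂y x y * slope ≈ -∂x x y
      meets    : slope ^ 2 + a₁ * slope - a₂ - x - x ≈ x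

  symᴾ = Setoid.sym pointSetoid
  transᴾ = Setoid.trans pointSetoid
  reflᴾ : ∀ {P} → P ≈ᴾ P
  reflᴾ = Setoid.refl pointSetoid

  negate-cong : ∀ {P Q} → P ≈ᴾ Q → negate P ≈ᴾ negate Q
  negate-cong 𝒪≈𝒪           = 𝒪≈𝒪
  negate-cong (aff≈ x≈ y≈) = aff≈ x≈ (+-congʳ (sub-cong (-‿cong y≈) (*-congˡ x≈)))

  onCurve-resp : ∀ {P Q} → P ≈ᴾ Q → P ∈ OnCurve → Q ∈ OnCurve
  onCurve-resp 𝒪≈𝒪          _ = tt
  onCurve-resp (aff≈ x≈ y≈) e = trans
    (sym (+-cong (+-cong (^-congˡ 2 y≈) (*-cong (*-congˡ x≈) y≈)) (*-congˡ y≈)))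
    (trans e (+-congʳ (+-cong (+-cong (^-congˡ 3 x≈) (*-congˡ (^-congˡ 2 x≈))) (*-congˡ x≈))))

  add-opposite : ∀ {x₁ y₁ x₂ y₂} → x₁ ≈ x₂ → y₁ + y₂ + a₁ * x₁ + a₃ ≈ 0# →
    add (aff x₁ y₁) (aff x₂ y₂) ≡ 𝒪
  add-opposite {x₁} {y₁} {x₂} {y₂} x₁≈x₂ d≈0 with x₂ - x₁ ≟ 0#
  ... | no x₂-x₁≉0 = contradiction (x≈y⇒x-y≈0 (sym x₁≈x₂)) x₂-x₁≉0
  ... | yes _ with y₁ + y₂ + a₁ * x₁ + a₃ ≟ 0#
  ...   | yes _  = ≡.refl
  ...   | no d≉0 = contradiction d≈0 d≉0

  -- `add` divides using the proof found by its own test; the equation determines the slope whatever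
  -- that proof is.
  add-tangent : ∀ {x₁ y₁ x₂ y₂} → x₁ ≈ x₂ → ¬ y₁ + y₂ + a₁ * x₁ + a₃ ≈ 0# →
    ∃ λ l → (y₁ + y₂ + a₁ * x₁ + a₃) * l ≈ -∂x x₁ y₁ ×
            add (aff x₁ y₁) (aff x₂ y₂) ≡ thirdPoint l x₁ y₁ x₂
  add-tangent {x₁} {y₁} {x₂} {y₂} x₁≈x₂ d≉0 with x₂ - x₁ ≟ 0#
  ... | no x₂-x₁≉0 = contradiction (x≈y⇒x-y≈0 (sym x₁≈x₂)) x₂-x₁≉0
  ... | yes _ with y₁ + y₂ + a₁ * x₁ + a₃ ≟ 0#
  ...   | yes d≈0 = contradiction d≈0 d≉0
  ...   | no d≉0′ = _ , *-divide _ _ d≉0′ , ≡.refl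

  -- For distinct abscissas `add` returns a `thirdPoint`, which is affine.
  add≈𝒪⇒x₁≈x₂ : ∀ {x₁ y₁ x₂ y₂} → add (aff x₁ y₁) (aff x₂ y₂) ≈ᴾ 𝒪 → x₁ ≈ x₂
  add≈𝒪⇒x₁≈x₂ {x₁} {y₁} {x₂} {y₂} sum≈𝒪 with x₂ - x₁ ≟ 0#
  ... | yes x₂-x₁≈0 = sym (x-y≈0⇒x≈y x₂-x₁≈0)
  add≈𝒪⇒x₁≈x₂ () | no _

  -- Since the double is not `𝒪`, the tangent is not vertical. Since adding the point once more
  -- gives `𝒪`, the double has the same abscissa `x`.
  order3⇒inflection : ∀ {x y} → OnCurve (aff x y) → HasOrder 3 (aff x y) → Inflection x y
  order3⇒inflection {x} {y} onCurve order3 = record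
    { onCurve = onCurve
    ; ∂y≉0    = ∂y≉0
    ; slope   = proj₁ double
    ; tangent = proj₁ (proj₂ double)
    ; meets   = sym (add≈𝒪⇒x₁≈x₂
        (≡.subst (λ Q → add (aff x y) Q ≈ᴾ 𝒪) (proj₂ (proj₂ double)) kills))
    }
    where
    open HasOrder order3
    ∂y≉0 : ¬ ∂y x y ≈ 0#
    ∂y≉0 ∂y≈0 = minimal 2 (ℕ.s≤s ℕ.z≤n) (ℕ.s≤s (ℕ.s≤s (ℕ.s≤s ℕ.z≤n)))
      (Setoid.reflexive pointSetoid (add-opposite refl ∂y≈0))
    double = add-tangent {x} {y} {x} {y} refl ∂y≉0

  -- The third intersection of the tangent is the point itself, so doubling amounts to negation. `P`
  -- and `Q` are given only up to `≈ᴾ`, as membership in `H` provides them.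
  add-double : ∀ {x y} → Inflection x y → ∀ {P Q} → P ≈ᴾ aff x y → Q ≈ᴾ aff x y →
    add P Q ≈ᴾ negate (aff x y)
  add-double {x} {y} I {aff x₁ y₁} {aff x₂ y₂} (aff≈ x₁≈x y₁≈y) (aff≈ x₂≈x y₂≈y)
    with add-tangent {y₂ = y₂} (trans x₁≈x (sym x₂≈x))
           (λ d≈0 → Inflection.∂y≉0 I (trans (sym d≈∂y) d≈0))
    where
    d≈∂y : y₁ + y₂ + a₁ * x₁ + a₃ ≈ ∂y x y
    d≈∂y = +-congʳ (+-cong (+-cong y₁≈y y₂≈y) (*-congˡ x₁≈x))
  ... | l , dl≈ , sum≡ = ≡.subst (_≈ᴾ negate (aff x y)) (≡.sym sum≡)
    (negate-cong (aff≈ x₃≈x (begin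
      l * (x₃ - x₁) + y₁  ≈⟨ +-cong (l ⊛ x≈y⇒x-y≈0 (trans x₃≈x (sym x₁≈x))) y₁≈y ⟩
      0# + y              ≈⟨ +-identityˡ y ⟩
      y                   ∎)))
    where
    open Inflection I
    x₃ : Carrier
    x₃ = l ^ 2 + a₁ * l - a₂ - x₁ - x₂
    l≈slope : l ≈ slope
    l≈slope = *-cancelˡ-nonZero ∂y≉0 (begin
      ∂y x y * l
        ≈⟨ *-congʳ (+-congʳ (+-cong (+-cong y₁≈y y₂≈y) (*-congˡ x₁≈x))) ⟨
      (y₁ + y₂ + a₁ * x₁ + a₃) * l
        ≈⟨ dl≈ ⟩
      -∂x x₁ y₁
        ≈⟨ sub-cong (+-congʳ (+-cong (×-congʳ 3 (^-congˡ 2 x₁≈x)) (×-congʳ 2 (*-congˡ x₁≈x))))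
                    (*-congˡ y₁≈y) ⟩
      -∂x x y
        ≈⟨ tangent ⟨
      ∂y x y * slope ∎)
    x₃≈x : x₃ ≈ x
    x₃≈x = trans
      (sub-cong (sub-cong (+-congʳ (+-cong (^-congˡ 2 l≈slope) (*-congˡ l≈slope))) x₁≈x) x₂≈x) meets

  -- The subgroup of order 3 formed by two opposite inflection points.

  module OppositeInflections {X Y₁ Y₂ : Carrier} (I₁ : Inflection X Y₁) (I₂ : Inflection X Y₂)
    (opposite : Y₁ + Y₂ + a₁ * X + a₃ ≈ 0#) where

    element : Fin 3 → Point Carrier
    element 0F = 𝒪
    element 1F = aff X Y₁
    element 2F = aff X Y₂

    -- The index carried by a membership proof serves directly as the bijection with `Fin 3`.
    H : Pred (Point Carrier) (c ⊔ ℓ)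
    H P = ∃ λ i → P ≈ᴾ element i

    opposite′ : Y₂ + Y₁ + a₁ * X + a₃ ≈ 0#
    opposite′ = trans (+-congʳ (+-congʳ (+-comm Y₂ Y₁))) opposite

    negate-element : ∀ {y y′} → y + y′ + a₁ * X + a₃ ≈ 0# → negate (aff X y) ≈ᴾ aff X y′
    negate-element {y} {y′} d≈0 = aff≈ refl (sym (x-y≈0⇒x≈y (trans
      (solve 4 (λ y y′ u v → y′ :- (:- y :- u :- v) := y :+ y′ :+ u :+ v) refl y y′ (a₁ * X) a₃) d≈0)))

    add-opposite-element : ∀ {y y′} → y + y′ + a₁ * X + a₃ ≈ 0# → ∀ {P Q} →
      P ≈ᴾ aff X y → Q ≈ᴾ aff X y′ → add P Q ≈ᴾ 𝒪
    add-opposite-element d≈0 (aff≈ x₁≈ y₁≈) (aff≈ x₂≈ y₂≈) =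
      Setoid.reflexive pointSetoid (add-opposite (trans x₁≈ (sym x₂≈))
        (trans (+-congʳ (+-cong (+-cong y₁≈ y₂≈) (*-congˡ x₁≈))) d≈0))

    add-identityˡ : ∀ {P Q} → P ≈ᴾ 𝒪 → add P Q ≈ᴾ Q
    add-identityˡ 𝒪≈𝒪 = reflᴾ

    add-identityʳ : ∀ {P Q} → Q ≈ᴾ 𝒪 → add P Q ≈ᴾ P
    add-identityʳ {𝒪}       𝒪≈𝒪 = 𝒪≈𝒪
    add-identityʳ {aff _ _} 𝒪≈𝒪 = reflᴾ

    isSubgroup : IsSubgroup H
    isSubgroup = record
      { onCurve       = λ (i , P≈) → onCurve-resp (symᴾ P≈) (element-onCurve i)
      ; respects      = λ P≈Q (i , P≈) → i , transᴾ (symᴾ P≈Q) P≈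
      ; 𝒪-closed      = 0F , 𝒪≈𝒪
      ; add-closed    = λ (i , P≈) (j , Q≈) → add-closed i j P≈ Q≈
      ; negate-closed = λ (i , P≈) → negate-closed i P≈
      }
      where
      element-onCurve : ∀ i → element i ∈ OnCurve
      element-onCurve 0F = tt
      element-onCurve 1F = Inflection.onCurve I₁
      element-onCurve 2F = Inflection.onCurve I₂

      add-closed : ∀ i j {P Q} → P ≈ᴾ element i → Q ≈ᴾ element j → add P Q ∈ H
      add-closed 0F j  P≈ Q≈ = j , transᴾ (add-identityˡ P≈) Q≈
      add-closed 1F 0F P≈ Q≈ = 1F , transᴾ (add-identityʳ Q≈) P≈
      add-closed 1F 1F P≈ Q≈ = 2F , transᴾ (add-double I₁ P≈ Q≈) (negate-element opposite)
      add-closed 1F 2F P≈ Q≈ = 0F , add-opposite-element opposite P≈ Q≈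
      add-closed 2F 0F P≈ Q≈ = 2F , transᴾ (add-identityʳ Q≈) P≈
      add-closed 2F 1F P≈ Q≈ = 0F , add-opposite-element opposite′ P≈ Q≈
      add-closed 2F 2F P≈ Q≈ = 1F , transᴾ (add-double I₂ P≈ Q≈) (negate-element opposite′)

      negate-closed : ∀ i {P} → P ≈ᴾ element i → negate P ∈ H
      negate-closed 0F P≈ = 0F , negate-cong P≈
      negate-closed 1F P≈ = 2F , transᴾ (negate-cong P≈) (negate-element opposite)
      negate-closed 2F P≈ = 1F , transᴾ (negate-cong P≈) (negate-element opposite′)

    -- Equal ordinates would turn `opposite` into the vanishing of `∂y`.
    Y₁≉Y₂ : ¬ Y₁ ≈ Y₂
    Y₁≉Y₂ Y₁≈Y₂ = Inflection.∂y≉0 I₁ (trans (+-congʳ (+-congʳ (+-congˡ Y₁≈Y₂))) opposite)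

    hasOrder3 : SubgroupHasOrder H 3
    hasOrder3 = record
      { to        = λ (_ , i , _) → i
      ; from      = λ i → element i , i , reflᴾ
      ; to-cong   = λ {(_ , i , P≈)} {(_ , j , Q≈)} P≈Q →
          element-injective i j (transᴾ (symᴾ P≈) (transᴾ P≈Q Q≈))
      ; from-cong = λ { ≡.refl → reflᴾ }
      ; inverse   = (λ {i} {(_ , j , Q≈)} Q≈i → element-injective j i (transᴾ (symᴾ Q≈) Q≈i))
                  , (λ { {_ , _ , P≈} ≡.refl → symᴾ P≈ })
      }
      where
      element-injective : ∀ i j → element i ≈ᴾ element j → i ≡ j
      element-injective 0F 0F _ = ≡.refl
      element-injective 0F 1F ()
      element-injective 0F 2F ()
      element-injective 1F 1F _ = ≡.refl
      element-injective 2F 2F _ = ≡.refl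
      element-injective 1F 2F (aff≈ _ Y₁≈Y₂) = contradiction Y₁≈Y₂ Y₁≉Y₂
      element-injective 2F 1F (aff≈ _ Y₂≈Y₁) = contradiction (sym Y₂≈Y₁) Y₁≉Y₂

-- The model η² + Aξη + Bη = ξ³ and its other inflection points.

module ThreeTorsion {c ℓ} (K : Field c ℓ) (W : Weierstrass (Field.Carrier K)) where
  open Field K hiding (zero)
  open Weierstrass W
  open GroupLaw K W
  open FieldProperties K
  open WeierstrassCurve K W
  open IntegerCoefficients commutativeRing
  open Algebra.Properties.CommutativeSemiring.Exp commutativeSemiring using (^-congˡ)
  open Algebra.Properties.Semiring.Mult semiring using (×-congʳ)

  module _ {x y : Carrier} (I : Inflection x y) where
    open Inflection I

    A B : Carrier
    A = a₁ + 2 · slope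
    B = ∂y x y

    private
      -- Along the tangent, at (x + ξ, y + slope · ξ), the curve equation reads f + gξ + hξ² - ξ³ =
      -- 0, with f, g, h the left sides of `f≈0`, `g≈0`, `h≈0`. Their vanishing is contact of order
      -- 3.
      f≈0 : y ^ 2 + a₁ * x * y + a₃ * y - (x ^ 3 + a₂ * x ^ 2 + a₄ * x + a₆) ≈ 0#
      f≈0 = x≈y⇒x-y≈0 onCurve

      g≈0 : ∂y x y * slope - -∂x x y ≈ 0#
      g≈0 = x≈y⇒x-y≈0 tangent

      h≈0 : slope ^ 2 + a₁ * slope - a₂ - x - x - x ≈ 0#
      h≈0 = x≈y⇒x-y≈0 meets

    -- The b-invariants of Y² + AXY + BY = X³, translated by x.
    b₂′ b₄′ b₆′ b₈′ : Carrier
    b₂′ = A ^ 2 - 12 · x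
    b₄′ = A * B - x * b₂′ - 6 · x ^ 2
    b₆′ = B ^ 2 - 2 · (x * b₄′) - x ^ 2 * b₂′ - 4 · x ^ 3
    b₈′ = - (3 · (x * b₆′) + 3 · (x ^ 2 * b₄′) + x ^ 3 * b₂′ + 3 · x ^ 4)

    -- Adding to Y an affine function of X preserves the b-invariants, so only the shift by `x`
    -- shows. The identities for b₂, b₄, b₆ come from h, g, f in turn, that for b₈ from all three.
    b₂≈ : a₁ ^ 2 + 4 · a₂ ≈ b₂′
    b₂≈ = x-y≈0⇒x≈y (trans
      (solve 4 (λ a₁ a₂ x l →
        a₁ :^ 2 :+ 4 :× a₂ :- ((a₁ :+ 2 :× l) :^ 2 :- 12 :× x)
        := con (ℤ.- (+ 4)) :* (l :^ 2 :+ a₁ :* l :- a₂ :- x :- x :- x)) refl a₁ a₂ x slope)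
      (_ ⊛ h≈0))

    b₄≈ : 2 · a₄ + a₁ * a₃ ≈ b₄′
    b₄≈ = trans (x-y≈0⇒x≈y (trans
      (solve 7 (λ a₁ a₂ a₃ a₄ x y l →
        let B = y :+ y :+ a₁ :* x :+ a₃ in
        2 :× a₄ :+ a₁ :* a₃ :- ((a₁ :+ 2 :× l) :* B :- x :* (a₁ :^ 2 :+ 4 :× a₂) :- 6 :× x :^ 2)
        := con (ℤ.- (+ 2)) :* (B :* l :- (3 :× x :^ 2 :+ 2 :× (a₂ :* x) :+ a₄ :- a₁ :* y)))
        refl a₁ a₂ a₃ a₄ x y slope)
      (_ ⊛ g≈0)))
      (sub-cong (sub-cong refl (*-congˡ b₂≈)) refl)

    b₆≈ : a₃ ^ 2 + 4 · a₆ ≈ b₆′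
    b₆≈ = trans (x-y≈0⇒x≈y (trans
      (solve 7 (λ a₁ a₂ a₃ a₄ a₆ x y →
        let B = y :+ y :+ a₁ :* x :+ a₃ in
        a₃ :^ 2 :+ 4 :× a₆ :- (B :^ 2 :- 2 :× (x :* (2 :× a₄ :+ a₁ :* a₃))
          :- x :^ 2 :* (a₁ :^ 2 :+ 4 :× a₂) :- 4 :× x :^ 3)
        := con (ℤ.- (+ 4)) :* (y :^ 2 :+ a₁ :* x :* y :+ a₃ :* y
             :- (x :^ 3 :+ a₂ :* x :^ 2 :+ a₄ :* x :+ a₆)))
        refl a₁ a₂ a₃ a₄ a₆ x y)
      (_ ⊛ f≈0)))
      (sub-cong (sub-cong (sub-cong refl (×-congʳ 2 (*-congˡ b₄≈))) (*-congˡ b₂≈)) refl)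

    b₈≈ : a₁ ^ 2 * a₆ + 4 · (a₂ * a₆) - a₁ * a₃ * a₄ + a₂ * a₃ ^ 2 - a₄ ^ 2 ≈ b₈′
    b₈≈ = trans (x-y≈0⇒x≈y (trans
      (solve 8 (λ a₁ a₂ a₃ a₄ a₆ x y l →
        let A = a₁ :+ 2 :× l ; B = y :+ y :+ a₁ :* x :+ a₃
            f = y :^ 2 :+ a₁ :* x :* y :+ a₃ :* y :- (x :^ 3 :+ a₂ :* x :^ 2 :+ a₄ :* x :+ a₆)
            g = B :* l :- (3 :× x :^ 2 :+ 2 :× (a₂ :* x) :+ a₄ :- a₁ :* y)
            h = l :^ 2 :+ a₁ :* l :- a₂ :- x :- x :- x
            b₂ = a₁ :^ 2 :+ 4 :× a₂ ; b₄ = 2 :× a₄ :+ a₁ :* a₃ ; b₆ = a₃ :^ 2 :+ 4 :× a₆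
            b₈ = a₁ :^ 2 :* a₆ :+ 4 :× (a₂ :* a₆) :- a₁ :* a₃ :* a₄ :+ a₂ :* a₃ :^ 2 :- a₄ :^ 2 in
          b₈ :- :- (3 :× (x :* b₆) :+ 3 :× (x :^ 2 :* b₄) :+ x :^ 3 :* b₂ :+ 3 :× x :^ 4)
          := (4 :× h :- A :^ 2) :* f :+ (A :* B :- g) :* g :+ :- B :^ 2 :* h)
        refl a₁ a₂ a₃ a₄ a₆ x y slope)
      (_ ⊛ f≈0 ⊕ _ ⊛ g≈0 ⊕ _ ⊛ h≈0)))
      (-‿cong (+-congʳ (+-cong
        (+-cong (×-congʳ 3 (*-congˡ b₆≈)) (×-congʳ 3 (*-congˡ b₄≈))) (*-congˡ b₂≈))))

    -- The discriminant is invariant under translation, so `x` drops out; at x = 0 the b-invariants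
    -- are A², AB, B² and 0.
    discriminant≈ : discriminant K W ≈ B ^ 3 * (A ^ 3 - 27 · B)
    discriminant≈ = trans
      (+-cong
        (sub-cong
          (sub-cong (-‿cong (*-cong (^-congˡ 2 b₂≈) b₈≈)) (×-congʳ 8 (^-congˡ 3 b₄≈)))
          (×-congʳ 27 (^-congˡ 2 b₆≈)))
        (×-congʳ 9 (*-cong (*-cong b₂≈ b₄≈) b₆≈)))
      (solve 3 (λ A B x →
        let b₂ = A :^ 2 :- 12 :× x ; b₄ = A :* B :- x :* b₂ :- 6 :× x :^ 2
            b₆ = B :^ 2 :- 2 :× (x :* b₄) :- x :^ 2 :* b₂ :- 4 :× x :^ 3
            b₈ = :- (3 :× (x :* b₆) :+ 3 :× (x :^ 2 :* b₄) :+ x :^ 3 :* b₂ :+ 3 :× x :^ 4) in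
          :- (b₂ :^ 2 :* b₈) :- 8 :× b₄ :^ 3 :- 27 :× b₆ :^ 2 :+ 9 :× (b₂ :* b₄ :* b₆)
          := B :^ 3 :* (A :^ 3 :- 27 :× B)) refl A B x)

    module Conjugates (nonsingular : ¬ discriminant K W ≈ 0#) (3≉0 : ¬ 3 · 1# ≈ 0#)
      {α ρ : Carrier} (3α≈A : 3 · α ≈ A) (ρ³≈α³-B : ρ ^ 3 ≈ α ^ 3 - B) where

      -- Apart from a factor 3ξ, the 3-division polynomial of the model is ξ³ + 3α²ξ² + 3αBξ + B².
      -- Its roots are -(α² + αρζ + ρ²ζ²) with ζ³ = 1, and `ξ` is the one for ζ = 1.
      σ ξ : Carrier
      σ = α ^ 2 + α * ρ + ρ ^ 2
      ξ = - σ

      X : Carrier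
      X = x + ξ

      -- slope + m ω is the slope of the tangent at (X , Y ω).
      η Y m : Carrier → Carrier
      η ω = σ * (α - ρ * ω)
      Y ω = y + slope * ξ + η ω
      m ω = (ω - 1#) * α + (2 · ω + 1#) * ρ

      private
        k≈0 : 3 · α - A ≈ 0#
        k≈0 = x≈y⇒x-y≈0 3α≈A

        b≈0 : ρ ^ 3 - (α ^ 3 - B) ≈ 0#
        b≈0 = x≈y⇒x-y≈0 ρ³≈α³-B

      -- The factor A³ - 27B of the discriminant equals 27ρ³.
      ρ≉0 : ¬ ρ ≈ 0#
      ρ≉0 ρ≈0 = nonsingular (trans discriminant≈ (_ ⊛ trans
        (solve 4 (λ A B α ρ →
          A :^ 3 :- 27 :× B
          := (27 :× ρ :^ 2) :* ρ :+ con (ℤ.- (+ 27)) :* (ρ :^ 3 :- (α :^ 3 :- B))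
             :+ :- (9 :× α :^ 2 :+ 3 :× (α :* A) :+ A :^ 2) :* (3 :× α :- A)) refl A B α ρ)
        (_ ⊛ ρ≈0 ⊕ _ ⊛ b≈0 ⊕ _ ⊛ k≈0)))

      -- The nonzero B factors as α³ - ρ³ = (α - ρ)σ.
      σ≉0 : ¬ σ ≈ 0#
      σ≉0 σ≈0 = ∂y≉0 (trans
        (solve 3 (λ B α ρ →
          B := (α :- ρ) :* (α :^ 2 :+ α :* ρ :+ ρ :^ 2) :+ con (+ 1) :* (ρ :^ 3 :- (α :^ 3 :- B))) refl B α ρ)
        (_ ⊛ σ≈0 ⊕ _ ⊛ b≈0))

      -- Isolates `ω`: once both coefficients are rational, Frobenius moves only `ω`, and
      -- rationality of `Y ω` would pass to `ω`.
      Y-linear : ∀ ω → Y ω ≈ - (σ * ρ) * ω + (y + slope * ξ + σ * α)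
      Y-linear ω = solve 5 (λ u σ α ρ ω →
        u :+ σ :* (α :- ρ :* ω) := :- (σ :* ρ) :* ω :+ (u :+ σ :* α)) refl (y + slope * ξ) σ α ρ ω

      -[σρ]≉0 : ¬ - (σ * ρ) ≈ 0#
      -[σρ]≉0 -[σρ]≈0 = *-nonZero σ≉0 ρ≉0 (trans
        (solve 1 (λ u → u := con (ℤ.- (+ 1)) :* :- u) refl (σ * ρ)) (_ ⊛ -[σρ]≈0))

      -- `ω′` is the second root -1 - ω. The relation is symmetric, so the results can be used with
      -- the two roots in either order.
      module _ {ω ω′ : Carrier} (ω+ω′+1≈0 : ω + ω′ + 1# ≈ 0#) where

        -- The two values of η must sum to -(Aξ + B), as roots of a quadratic over one abscissa;
        -- both quantities equal σ(2α + ρ).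
        Y-opposite : Y ω + Y ω′ + a₁ * X + a₃ ≈ 0#
        Y-opposite = trans
          (solve 9 (λ a₁ a₃ x y l α ρ ω ω′ →
            let σ = α :^ 2 :+ α :* ρ :+ ρ :^ 2 ; ξ = :- σ
                Y = λ ω → y :+ l :* ξ :+ σ :* (α :- ρ :* ω)
                A = a₁ :+ 2 :× l ; B = y :+ y :+ a₁ :* x :+ a₃ in
            Y ω :+ Y ω′ :+ a₁ :* (x :+ ξ) :+ a₃
            := :- (ρ :* σ) :* (ω :+ ω′ :+ con (+ 1)) :+ σ :* (3 :× α :- A)
               :+ con (+ 1) :* (ρ :^ 3 :- (α :^ 3 :- B)))
            refl a₁ a₃ x y slope α ρ ω ω′)
          (_ ⊛ ω+ω′+1≈0 ⊕ _ ⊛ k≈0 ⊕ _ ⊛ b≈0)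

        module _ (ω²+ω+1≈0 : ω ^ 2 + ω + 1# ≈ 0#) where

          -- The square of the difference is -3, the discriminant of T² + T + 1.
          ω-ω′≉0 : ¬ ω - ω′ ≈ 0#
          ω-ω′≉0 ω-ω′≈0 = 3≉0 (trans
            (solve 2 (λ ω ω′ →
              let s = ω :+ ω′ :+ con (+ 1) ; d = ω :- ω′ ; t = 2 :× ω :+ con (+ 1) in
              3 :× con (+ 1) := con (+ 4) :* (ω :^ 2 :+ ω :+ con (+ 1)) :+ (:- t) :* s :+ (:- t) :* d)
              refl ω ω′)
            (_ ⊛ ω²+ω+1≈0 ⊕ _ ⊛ ω+ω′+1≈0 ⊕ _ ⊛ ω-ω′≈0))

          -- By `Y-opposite`, this derivative equals `Y ω - Y ω′`, which is `- (σ * ρ) * (ω - ω′)`.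
          ∂y-nonZero : ¬ ∂y X (Y ω) ≈ 0#
          ∂y-nonZero ∂y≈0 = *-nonZero -[σρ]≉0 ω-ω′≉0 (trans
            (solve 8 (λ u σ α ρ ω ω′ v a₃ →
              let Y = λ ω → u :+ σ :* (α :- ρ :* ω) in
              :- (σ :* ρ) :* (ω :- ω′)
              := con (+ 1) :* (Y ω :+ Y ω :+ v :+ a₃) :+ con (ℤ.- (+ 1)) :* (Y ω :+ Y ω′ :+ v :+ a₃))
              refl (y + slope * ξ) σ α ρ ω ω′ (a₁ * X) a₃)
            (_ ⊛ ∂y≈0 ⊕ _ ⊛ Y-opposite))

          -- The equation splits as f + gξ + hξ² + (η² + Aξη + Bη - ξ³). With A = 3α and B = α³ -
          -- ρ³, the bracket is σ²ρ²(ω² + ω + 1).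
          onCurve′ : OnCurve (aff X (Y ω))
          onCurve′ = x-y≈0⇒x≈y (trans
            (solve 10 (λ a₁ a₂ a₃ a₄ a₆ x y l ξ η →
              (y :+ l :* ξ :+ η) :^ 2 :+ a₁ :* (x :+ ξ) :* (y :+ l :* ξ :+ η) :+ a₃ :* (y :+ l :* ξ :+ η)
                :- ((x :+ ξ) :^ 3 :+ a₂ :* (x :+ ξ) :^ 2 :+ a₄ :* (x :+ ξ) :+ a₆)
              := con (+ 1) :* (y :^ 2 :+ a₁ :* x :* y :+ a₃ :* y :- (x :^ 3 :+ a₂ :* x :^ 2 :+ a₄ :* x :+ a₆))
                :+ ξ :* ((y :+ y :+ a₁ :* x :+ a₃) :* l :- (3 :× x :^ 2 :+ 2 :× (a₂ :* x) :+ a₄ :- a₁ :* y))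
                :+ ξ :^ 2 :* (l :^ 2 :+ a₁ :* l :- a₂ :- x :- x :- x)
                :+ (η :* (η :+ (a₁ :+ 2 :× l) :* ξ :+ (y :+ y :+ a₁ :* x :+ a₃)) :- ξ :^ 3))
              refl a₁ a₂ a₃ a₄ a₆ x y slope ξ (η ω))
            (_ ⊛ f≈0 ⊕ _ ⊛ g≈0 ⊕ _ ⊛ h≈0 ⊕ trans
              (solve 5 (λ A B α ρ ω →
                let σ = α :^ 2 :+ α :* ρ :+ ρ :^ 2 ; ξ = :- σ ; η = σ :* (α :- ρ :* ω) in
                η :* (η :+ A :* ξ :+ B) :- ξ :^ 3
                := σ :^ 2 :* ρ :^ 2 :* (ω :^ 2 :+ ω :+ con (+ 1))
                   :+ :- (η :* ξ) :* (3 :× α :- A) :+ η :* (ρ :^ 3 :- (α :^ 3 :- B)))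
                refl A B α ρ ω)
              (_ ⊛ ω²+ω+1≈0 ⊕ _ ⊛ k≈0 ⊕ _ ⊛ b≈0)))

          -- The same splitting, differentiated: g + 2hξ plus the tangency condition on the model at
          -- (ξ, η) with slope `m ω`.
          tangent′ : ∂y X (Y ω) * (slope + m ω) ≈ -∂x X (Y ω)
          tangent′ = x-y≈0⇒x≈y (trans
            (solve 10 (λ a₁ a₂ a₃ a₄ x y l ξ η m →
              let X = x :+ ξ ; Y = y :+ l :* ξ :+ η ; A = a₁ :+ 2 :× l ; B = y :+ y :+ a₁ :* x :+ a₃ in
              (Y :+ Y :+ a₁ :* X :+ a₃) :* (l :+ m) :- (3 :× X :^ 2 :+ 2 :× (a₂ :* X) :+ a₄ :- a₁ :* Y)
              := con (+ 1) :* (B :* l :- (3 :× x :^ 2 :+ 2 :× (a₂ :* x) :+ a₄ :- a₁ :* y))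
                 :+ (2 :× ξ) :* (l :^ 2 :+ a₁ :* l :- a₂ :- x :- x :- x)
                 :+ (A :* η :- 3 :× ξ :^ 2 :+ m :* (2 :× η :+ A :* ξ :+ B)))
              refl a₁ a₂ a₃ a₄ x y slope ξ (η ω) (m ω))
            (_ ⊛ g≈0 ⊕ _ ⊛ h≈0 ⊕ trans
              (solve 5 (λ A B α ρ ω →
                let σ = α :^ 2 :+ α :* ρ :+ ρ :^ 2 ; ξ = :- σ ; η = σ :* (α :- ρ :* ω)
                    m = (ω :- con (+ 1)) :* α :+ (2 :× ω :+ con (+ 1)) :* ρ in
                A :* η :- 3 :× ξ :^ 2 :+ m :* (2 :× η :+ A :* ξ :+ B)
                := :- (σ :* (2 :× (α :* ρ) :+ 4 :× ρ :^ 2)) :* (ω :^ 2 :+ ω :+ con (+ 1))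
                   :+ :- (η :+ m :* ξ) :* (3 :× α :- A) :+ m :* (ρ :^ 3 :- (α :^ 3 :- B)))
                refl A B α ρ ω)
              (_ ⊛ ω²+ω+1≈0 ⊕ _ ⊛ k≈0 ⊕ _ ⊛ b≈0)))

          -- After subtracting h, what remains is the condition m² + Am = 3ξ on the model.
          meets′ : (slope + m ω) ^ 2 + a₁ * (slope + m ω) - a₂ - X - X ≈ X
          meets′ = x-y≈0⇒x≈y (trans
            (solve 7 (λ a₁ a₂ x l α ρ ω →
              let σ = α :^ 2 :+ α :* ρ :+ ρ :^ 2 ; X = x :+ :- σ
                  m = (ω :- con (+ 1)) :* α :+ (2 :× ω :+ con (+ 1)) :* ρ in
              (l :+ m) :^ 2 :+ a₁ :* (l :+ m) :- a₂ :- X :- X :- X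
              := con (+ 1) :* (l :^ 2 :+ a₁ :* l :- a₂ :- x :- x :- x)
                 :+ (α :^ 2 :+ 4 :× (α :* ρ) :+ 4 :× ρ :^ 2) :* (ω :^ 2 :+ ω :+ con (+ 1))
                 :+ :- m :* (3 :× α :- (a₁ :+ 2 :× l)))
              refl a₁ a₂ x slope α ρ ω)
            (_ ⊛ h≈0 ⊕ _ ⊛ ω²+ω+1≈0 ⊕ _ ⊛ k≈0))

          inflection : Inflection X (Y ω)
          inflection = record
            { onCurve = onCurve′
            ; ∂y≉0    = ∂y-nonZero
            ; slope   = slope + m ω
            ; tangent = tangent′
            ; meets   = meets′
            }

-- The second rational subgroup.

module _ {c ℓ c′ ℓ′} (F : Field c ℓ) (q : ℕ) (F-finite : HasCardinality (Field.setoid F) q)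
  (3∣q+1 : 3 ∣ q ℕ.+ 1) (K : Field c′ ℓ′) (ι : Field.Carrier F → Field.Carrier K)
  (K-closure : IsAlgebraicClosure F K ι) (E : EllipticCurve F) where
  private
    W = EllipticCurve.weierstrass E
    module F = Field F
    module W = Weierstrass W
  open IsAlgebraicClosure K-closure using (algebraicallyClosed) renaming (isRingHomomorphism to ι-hom)
  open Field K hiding (zero)
  open Weierstrass (mapWeierstrass ι W)
  open BaseChange F K ι E
  open FieldProperties K
  open FieldHomomorphism F K ι ι-hom
  open Frobenius F F-finite K ι ι-hom
  open WeierstrassCurve K (mapWeierstrass ι W)
  open ThreeTorsion K (mapWeierstrass ι W)
  open IntegerCoefficients commutativeRing
  open Algebra.Properties.CommutativeSemiring.Exp commutativeSemiring using (^-congˡ; ^-distrib-*)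
  open Algebra.Properties.Semiring.Mult semiring using (×-congʳ)
  open Relation.Binary.Reasoning.Setoid setoid

  -- An integer polynomial in the coefficients commutes with `ι`. This carries nonsingularity from
  -- `F` to `K`.
  discriminant-homo : ι (discriminant F W) ≈ discriminant K (mapWeierstrass ι W)
  discriminant-homo =
    +-homo′
      (sub-homo′
        (sub-homo′ (neg-homo′ (*-homo′ (^-homo′ 2 b₂) b₈)) (·-homo′ 8 (^-homo′ 3 b₄)))
        (·-homo′ 27 (^-homo′ 2 b₆)))
      (·-homo′ 9 (*-homo′ (*-homo′ b₂ b₄) b₆))
    where
    +-homo′ : ∀ {u v y z} → ι u ≈ y → ι v ≈ z → ι (u F.+ v) ≈ y + z
    +-homo′ y z = trans (+-homo _ _) (+-cong y z)
    *-homo′ : ∀ {u v y z} → ι u ≈ y → ι v ≈ z → ι (u F.* v) ≈ y * z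
    *-homo′ y z = trans (*-homo _ _) (*-cong y z)
    neg-homo′ : ∀ {u y} → ι u ≈ y → ι (F.- u) ≈ - y
    neg-homo′ y = trans (-‿homo _) (-‿cong y)
    sub-homo′ : ∀ {u v y z} → ι u ≈ y → ι v ≈ z → ι (u F.- v) ≈ y - z
    sub-homo′ y z = +-homo′ y (neg-homo′ z)
    ·-homo′ : ∀ n {u y} → ι u ≈ y → ι (n F.· u) ≈ n · y
    ·-homo′ n y = trans (·-homo n _) (×-congʳ n y)
    ^-homo′ : ∀ n {u y} → ι u ≈ y → ι (u F.^ n) ≈ y ^ n
    ^-homo′ n y = trans (^-homo n _) (^-congˡ n y)
    b₂ : ι (W.a₁ F.^ 2 F.+ 4 F.· W.a₂) ≈ a₁ ^ 2 + 4 · a₂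
    b₂ = +-homo′ (^-homo′ 2 refl) (·-homo′ 4 refl)
    b₄ : ι (2 F.· W.a₄ F.+ W.a₁ F.* W.a₃) ≈ 2 · a₄ + a₁ * a₃
    b₄ = +-homo′ (·-homo′ 2 refl) (*-homo′ refl refl)
    b₆ : ι (W.a₃ F.^ 2 F.+ 4 F.· W.a₆) ≈ a₃ ^ 2 + 4 · a₆
    b₆ = +-homo′ (^-homo′ 2 refl) (·-homo′ 4 refl)
    b₈ : ι (W.a₁ F.^ 2 F.* W.a₆ F.+ 4 F.· (W.a₂ F.* W.a₆)
            F.- W.a₁ F.* W.a₃ F.* W.a₄ F.+ W.a₂ F.* W.a₃ F.^ 2 F.- W.a₄ F.^ 2)
      ≈ a₁ ^ 2 * a₆ + 4 · (a₂ * a₆) - a₁ * a₃ * a₄ + a₂ * a₃ ^ 2 - a₄ ^ 2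
    b₈ = sub-homo′
      (+-homo′
        (sub-homo′
          (+-homo′ (*-homo′ (^-homo′ 2 refl) refl) (·-homo′ 4 (*-homo′ refl refl)))
          (*-homo′ (*-homo′ refl refl) refl))
        (*-homo′ refl (^-homo′ 2 refl)))
      (^-homo′ 2 refl)

  nonsingular : ¬ discriminant K (mapWeierstrass ι W) ≈ 0#
  nonsingular Δ≈0 = ι≉0 (EllipticCurve.nonsingular E) (trans discriminant-homo Δ≈0)

  ω²+ω+1≈0⇒ω³≈1 : ∀ {ω} → ω ^ 2 + ω + 1# ≈ 0# → ω ^ 3 ≈ 1#
  ω²+ω+1≈0⇒ω³≈1 {ω} e = x-y≈0⇒x≈y (trans
    (solve 1 (λ ω → ω :^ 3 :- con (+ 1) := (ω :- con (+ 1)) :* (ω :^ 2 :+ ω :+ con (+ 1))) refl ω) (_ ⊛ e))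

  -- A rational `ω` would be a rational cube root of unity, hence 1, and ω² + ω + 1 would be 3.
  ω-irrational : ∀ {ω} → ω ^ 2 + ω + 1# ≈ 0# → ¬ Rational ω
  ω-irrational {ω} e ω-rational = 3≉0 3∣q+1 (trans
    (solve 1 (λ ω → 3 :× con (+ 1) := con (+ 1) :* (ω :^ 2 :+ ω :+ con (+ 1))
      :+ (:- (ω :+ con (+ 2))) :* (ω :- con (+ 1))) refl ω)
    (_ ⊛ e ⊕ _ ⊛ x≈y⇒x-y≈0 (z³≈1⇒z≈1 3∣q+1 ω-rational (ω²+ω+1≈0⇒ω³≈1 e))))

  -- Both are inverse to `ω`: the power because 3 divides q + 1, and `ω′` because ωω′ = -ω² - ω = 1.
  ω^q≈ω′ : ∀ {ω ω′} → ω ^ 2 + ω + 1# ≈ 0# → ω + ω′ + 1# ≈ 0# → ω ^ q ≈ ω′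
  ω^q≈ω′ {ω} {ω′} e e′ = *-cancelˡ-nonZero ω≉0 (begin
    ω * ω ^ q  ≈⟨ z³≈1⇒z*z^q≈1 3∣q+1 (ω²+ω+1≈0⇒ω³≈1 e) ⟩
    1#         ≈⟨ x-y≈0⇒x≈y (trans
      (solve 2 (λ ω ω′ → con (+ 1) :- ω :* ω′
        := con (+ 1) :* (ω :^ 2 :+ ω :+ con (+ 1)) :+ (:- ω) :* (ω :+ ω′ :+ con (+ 1))) refl ω ω′)
      (_ ⊛ e ⊕ _ ⊛ e′)) ⟩
    ω * ω′     ∎)
    where
    ω≉0 : ¬ ω ≈ 0#
    ω≉0 ω≈0 = 1≉0 (trans
      (solve 1 (λ ω → con (+ 1)
        := con (+ 1) :* (ω :^ 2 :+ ω :+ con (+ 1)) :+ (:- (ω :+ con (+ 1))) :* ω) refl ω)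
      (_ ⊛ e ⊕ _ ⊛ ω≈0))

  a₁-rational : Rational a₁
  a₁-rational = W.a₁ , refl
  a₂-rational : Rational a₂
  a₂-rational = W.a₂ , refl
  a₃-rational : Rational a₃
  a₃-rational = W.a₃ , refl
  a₄-rational : Rational a₄
  a₄-rational = W.a₄ , refl

  rationalTorsion⇒otherSubgroup : (P : Point Carrier) →
    P ∈ OnCurve → P ∈ DefinedOver F K ι → HasOrder 3 P →
    ∃ λ (H : Pred (Point (Field.Carrier K)) (c′ ⊔ ℓ′)) →
    IsSubgroup H × SubgroupHasOrder H 3 × FrobeniusStable q H ×
    ¬ (H ≐ ⟨ P ⟩) ×
    (∀ {Q} → Q ∈ H → ¬ Q ≈ᴾ 𝒪 → ¬ (Q ∈ DefinedOver F K ι))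
  rationalTorsion⇒otherSubgroup 𝒪 _ _ order3 =
    -- `1 ⋆ 𝒪` already computes to `𝒪`, so the point at infinity cannot have order 3.
    contradiction 𝒪≈𝒪 (HasOrder.minimal order3 1 (ℕ.s≤s ℕ.z≤n) (ℕ.s≤s (ℕ.s≤s ℕ.z≤n)))
  rationalTorsion⇒otherSubgroup P@(aff x y) P∈E (u , v , x≈ιu , y≈ιv) order3 =
    H , isSubgroup , hasOrder3 , frobeniusStable
      -- Were the subgroups equal, `H` would contain the rational affine point `P`.
      , (λ H≐⟨P⟩ → irrational (proj₂ H≐⟨P⟩ generator) (λ ()) (u , v , x≈ιu , y≈ιv))
      , irrational
    where
    I : Inflection x y
    I = order3⇒inflection P∈E order3
    open Inflection I using (slope; tangent; ∂y≉0)

    x-rational : Rational x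
    x-rational = u , x≈ιu
    y-rational : Rational y
    y-rational = v , y≈ιv

    B-rational : Rational (∂y x y)
    B-rational = +-rational
      (+-rational (+-rational y-rational y-rational) (*-rational a₁-rational x-rational)) a₃-rational

    slope-rational : Rational slope
    slope-rational = quotient-rational ∂y≉0 tangent B-rational
      (sub-rational (+-rational (+-rational (·-rational 3 (^-rational 2 x-rational))
        (·-rational 2 (*-rational a₂-rational x-rational))) a₄-rational) (*-rational a₁-rational y-rational))

    A-rational : Rational (A I)
    A-rational = +-rational a₁-rational (·-rational 2 slope-rational)

    α : Carrier
    α = divide (A I) (3 · 1#) (3≉0 3∣q+1)

    3*α≈A : 3 · 1# * α ≈ A I
    3*α≈A = *-divide _ _ (3≉0 3∣q+1)

    α-rational : Rational α
    α-rational = quotient-rational (3≉0 3∣q+1) 3*α≈A (·-rational 3 1-rational) A-rational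

    -- The root is taken among rational elements, so that `σ`, `X` and the coefficients of
    -- `Y-linear` are fixed by Frobenius.
    cubeRoot-ρ = cubeRoot 3∣q+1 (sub-rational (^-rational 3 α-rational) B-rational)
    ρ = proj₁ cubeRoot-ρ
    ρ-rational = proj₁ (proj₂ cubeRoot-ρ)

    open Conjugates I nonsingular (3≉0 3∣q+1) {α} {ρ}
      (trans (solve 1 (λ α → 3 :× α := (3 :× con (+ 1)) :* α) refl α) 3*α≈A) (proj₂ (proj₂ cubeRoot-ρ))

    σ-rational : Rational σ
    σ-rational = +-rational
      (+-rational (^-rational 2 α-rational) (*-rational α-rational ρ-rational)) (^-rational 2 ρ-rational)

    X-rational : Rational X
    X-rational = +-rational x-rational (neg-rational σ-rational)

    d e : Carrier
    d = - (σ * ρ)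
    e = y + slope * ξ + σ * α

    d-rational : Rational d
    d-rational = neg-rational (*-rational σ-rational ρ-rational)

    e-rational : Rational e
    e-rational = +-rational
      (+-rational y-rational (*-rational slope-rational (neg-rational σ-rational)))
      (*-rational σ-rational α-rational)

    Y-irrational : ∀ {ω} → ω ^ 2 + ω + 1# ≈ 0# → ¬ Rational (Y ω)
    Y-irrational {ω} ω²+ω+1≈0 Y-rational = ω-irrational ω²+ω+1≈0
      (quotient-rational -[σρ]≉0
        (trans (solve 2 (λ u e → u := u :+ e :- e) refl (d * ω) e) (+-congʳ (sym (Y-linear ω))))
        d-rational (sub-rational Y-rational e-rational))

    Y^q : ∀ {ω ω′} → ω ^ 2 + ω + 1# ≈ 0# → ω + ω′ + 1# ≈ 0# → Y ω ^ q ≈ Y ω′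
    Y^q {ω} {ω′} ω²+ω+1≈0 ω+ω′+1≈0 = begin
      Y ω ^ q              ≈⟨ ^-congˡ q (Y-linear ω) ⟩
      (d * ω + e) ^ q      ≈⟨ [z+b]^q≈z^q+b e-rational (d * ω) ⟩
      (d * ω) ^ q + e      ≈⟨ +-congʳ (^-distrib-* d ω q) ⟩
      d ^ q * ω ^ q + e    ≈⟨ +-congʳ (*-cong (^q-rational d-rational) (ω^q≈ω′ ω²+ω+1≈0 ω+ω′+1≈0)) ⟩
      d * ω′ + e           ≈⟨ Y-linear ω′ ⟨
      Y ω′                 ∎

    ω ω′ : Carrier
    -- The coefficients 1, 1 encode the monic quadratic 1 + T + T².
    ω  = proj₁ (algebraicallyClosed 1# (1# ∷ []))
    ω′ = - 1# - ω

    ω²+ω+1≈0 : ω ^ 2 + ω + 1# ≈ 0#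
    ω²+ω+1≈0 = trans
      (solve 1 (λ ω → ω :^ 2 :+ ω :+ con (+ 1) := con (+ 1) :+ ω :* (con (+ 1) :+ ω :* con (+ 1))) refl ω)
      (proj₂ (algebraicallyClosed 1# (1# ∷ [])))

    ω′²+ω′+1≈0 : ω′ ^ 2 + ω′ + 1# ≈ 0#
    ω′²+ω′+1≈0 = trans
      (solve 1 (λ ω → let ω′ = :- con (+ 1) :- ω in
        ω′ :^ 2 :+ ω′ :+ con (+ 1) := ω :^ 2 :+ ω :+ con (+ 1)) refl ω) ω²+ω+1≈0

    ω+ω′+1≈0 : ω + ω′ + 1# ≈ 0#
    ω+ω′+1≈0 = solve 1 (λ ω → ω :+ (:- con (+ 1) :- ω) :+ con (+ 1) := con (+ 0)) refl ω

    ω′+ω+1≈0 : ω′ + ω + 1# ≈ 0#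
    ω′+ω+1≈0 = trans (+-congʳ (+-comm ω′ ω)) ω+ω′+1≈0

    open OppositeInflections
      (inflection ω+ω′+1≈0 ω²+ω+1≈0) (inflection ω′+ω+1≈0 ω′²+ω′+1≈0)
      (Y-opposite ω+ω′+1≈0)

    X^q : X ^ q ≈ X
    X^q = ^q-rational X-rational

    frobeniusStable : FrobeniusStable q H
    frobeniusStable (0F , 𝒪≈𝒪) = 0F , 𝒪≈𝒪
    frobeniusStable (1F , aff≈ x≈ y≈) =
      2F , aff≈ (trans (^-congˡ q x≈) X^q) (trans (^-congˡ q y≈) (Y^q ω²+ω+1≈0 ω+ω′+1≈0))
    frobeniusStable (2F , aff≈ x≈ y≈) =
      1F , aff≈ (trans (^-congˡ q x≈) X^q) (trans (^-congˡ q y≈) (Y^q ω′²+ω′+1≈0 ω′+ω+1≈0))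

    -- The obstruction lies in the ordinate, the abscissa `X` being rational.
    irrational : ∀ {Q} → Q ∈ H → ¬ Q ≈ᴾ 𝒪 → ¬ (Q ∈ DefinedOver F K ι)
    irrational (0F , Q≈𝒪)      Q≉𝒪 _                   = Q≉𝒪 Q≈𝒪
    irrational (1F , aff≈ _ y≈) _   (_ , _ , _ , y-rational) =
      Y-irrational ω²+ω+1≈0 (_ , trans (sym y≈) y-rational)
    irrational (2F , aff≈ _ y≈) _   (_ , _ , _ , y-rational) =
      Y-irrational ω′²+ω′+1≈0 (_ , trans (sym y≈) y-rational)

open import Data.Nat.Base using (_+_)

mainTheorem1 : ∀ {c ℓ c′ ℓ′} (F : Field c ℓ) (q : ℕ) →
    HasCardinality (Field.setoid F) q →
    3 ∣ q + 1 →
    (K : Field c′ ℓ′) (ι : Field.Carrier F → Field.Carrier K) →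
    IsAlgebraicClosure F K ι →
    (E : EllipticCurve F) →
    let open BaseChange F K ι E in
    (P : Point (Field.Carrier K)) →
    P ∈ OnCurve → P ∈ DefinedOver F K ι → HasOrder 3 P →
    ∃ λ (H : Pred (Point (Field.Carrier K)) (c′ ⊔ ℓ′)) →
    IsSubgroup H × SubgroupHasOrder H 3 × FrobeniusStable q H ×
    ¬ (H ≐ ⟨ P ⟩) ×
    (∀ {Q} → Q ∈ H → ¬ Q ≈ᴾ 𝒪 → ¬ (Q ∈ DefinedOver F K ι))
mainTheorem1 = rationalTorsion⇒otherSubgroup
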